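{- Let $c,k$ be fixed positive integers and let $s=s(n)$ be a positive-integer-valued function. (1) If $c=k+1$ and $s(n)>c$ for all $n$, then $p(n,c,k,s(n))=1-o(1)$, i.e. $\lim_{n\to\infty}p(n,c,k,s(n))=1$. (2) If $c>k+1$ and $s(n)\ge c$ for all $n$, then $p(n,c,k,s(n))=1-o(1)$, i.e. $\lim_{n\to\infty}p(n,c,k,s(n))=1$.
   Context: $C_n^k$ denotes the $k$-th power of the cycle on $n$ vertices: its vertex set is $\{0,\ldots,n-1\}$, and distinct vertices $i,j$ are adjacent iff $(i-j) \bmod n\in\{ -k,\ldots,-1,1,\ldots,k\}$ (residues modulo $n$), i.e. iff their distance along the cycle is at most $k$. Given a set $L(x)$ of colours for each vertex $x$ of a graph $G$, an $L$-colouring of $G$ is a map $f$ from $V(G)$ to the colours with $f(x)\in L(x)$ for all $x\in V(G)$ and $f(x)\ne f(y)$ for every edge $(x,y)\in E(G)$; $G$ is $L$-colourable if it has an $L$-colouring. Let $\mathcal{S}$ be a set of colours of size $s(n)$. For each vertex of $C_n^k$, independently, draw a subset of $\mathcal{S}$ of size $c$ uniformly at random among all $c$-element subsets of $\mathcal{S}$; this gives a random list assignment $L$. Then $p(n,c,k,s(n))$ is the probability that $C_n^k$ is $L$-colourable. The parameters $c,k$ are fixed, $s(n)$ may depend arbitrarily on $n$ subject to the stated inequality, and all asymptotics are as $n\to\infty$; $o(1)$ denotes a quantity tending to $0$. -}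

module Defs where

open import Data.Bool.Base using (Bool; true; false)
open import Data.Fin.Base using (Fin; zero; suc; toℕ)
import Data.Fin.Properties as Fin
open import Data.Fin.Subset using (Subset; inside; outside; ∣_∣; ⊥; _∈_)
open import Data.Fin.Subset.Properties using (_∈?_; ∣⊥∣≡0)
open import Data.Integer.Base as ℤ using (+_)
open import Data.Integer.Divisibility.Signed using (_∣_; _∣?_)
open import Data.List.Base using (List; []; _∷_; length; filter; allFin; cartesianProductWith)
open import Data.List.Membership.Propositional using (find; lose) renaming (_∈_ to _∈ˡ_)
open import Data.List.Membership.Propositional.Properties
  using (∈-cartesianProductWith⁺; ∈-filter⁺; ∈-length; ∈-allFin)
open import Data.List.Relation.Unary.Any using (any?; here; there)
open import Data.Nat.Base as ℕ using (ℕ; zero; suc; _≤_; _<_; z≤n; s≤s; NonZero; >-nonZero)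
import Data.Nat.Properties as ℕ
open import Data.Product.Base using (∃; _×_; _,_; proj₁; proj₂)
open import Data.Rational.Base as ℚ using (ℚ; 0ℚ; _/_)
open import Data.Sum.Base using (_⊎_)
open import Data.Vec.Base using (Vec; []; _∷_; lookup; tabulate; replicate)
open import Data.Vec.Properties using (lookup∘tabulate)
open import Level using (0ℓ)
open import Relation.Binary.Core using (Rel)
open import Relation.Binary.Definitions using () renaming (Decidable to Decidable₂)
open import Relation.Binary.PropositionalEquality using (_≡_; _≢_; refl; sym; cong; subst; subst₂)
open import Relation.Nullary.Decidable using (Dec; map′; ¬?; _×-dec_; _⊎-dec_; _→-dec_)
open import Relation.Unary using (Pred; Decidable)

-- Adjacency in the k-th power of the n-cycle: i - j is congruent to d or to
-- -d modulo n for some 1 ≤ d ≤ k.  The condition i ≢ j matters when n ≤ k,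
-- where d may be a multiple of n.
CyclePower : (n k : ℕ) → Rel (Fin n) 0ℓ
CyclePower n k i j = i ≢ j × ∃ λ d → d < suc k × 1 ≤ d ×
  ((+ n ∣ (+ toℕ i ℤ.- + toℕ j) ℤ.- + d) ⊎ (+ n ∣ (+ toℕ i ℤ.- + toℕ j) ℤ.+ + d))

cyclePower? : ∀ n k → Decidable₂ (CyclePower n k)
cyclePower? n k i j = ¬? (i Fin.≟ j) ×-dec
  ℕ.anyUpTo? (λ d → (1 ℕ.≤? d) ×-dec ((_ ∣? _) ⊎-dec (_ ∣? _))) (suc k)

module _ {n s : ℕ} (_~_ : Rel (Fin n) 0ℓ) (L : Fin n → Subset s) where

  IsColouring : Pred (Fin n → Fin s) 0ℓ
  IsColouring f = (∀ x → f x ∈ L x) × (∀ x y → x ~ y → f x ≢ f y)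

  Colourable : Set
  Colourable = ∃ IsColouring

module _ {A : Set} where

  -- All vectors of length n with entries in xs; free of repetitions whenever
  -- xs is.
  vectors : List A → (n : ℕ) → List (Vec A n)
  vectors xs zero    = [] ∷ []
  vectors xs (suc n) = cartesianProductWith _∷_ xs (vectors xs n)

  ∈-vectors : ∀ {xs n} (v : Vec A n) → (∀ i → lookup v i ∈ˡ xs) → v ∈ˡ vectors xs n
  ∈-vectors []      _ = here refl
  ∈-vectors (x ∷ v) h = ∈-cartesianProductWith⁺ _∷_ (h zero)
    (∈-vectors v (λ i → h (suc i)))

  -- The probability of P under the uniform distribution on the entries of xs.
  probability : (xs : List A) .{{_ : NonZero (length xs)}} {P : Pred A 0ℓ} → Decidable P → ℚ
  probability xs P? = + length (filter P? xs) / length xs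

colourable? : ∀ {n s} {_~_ : Rel (Fin n) 0ℓ} → Decidable₂ _~_ →
              (L : Fin n → Subset s) → Dec (Colourable _~_ L)
colourable? {n} {s} {_~_} _~?_ L = map′ from to
  (any? (λ v → isColouring? (lookup v)) (vectors (allFin s) n))
  where
  isColouring? : Decidable (IsColouring _~_ L)
  isColouring? f = Fin.all? (λ x → f x ∈? L x) ×-dec
    Fin.all? (λ x → Fin.all? (λ y → (x ~? y) →-dec ¬? (f x Fin.≟ f y)))

  from = λ a → let v , _ , p = find a in lookup v , p

  to : Colourable _~_ L → _
  to (f , f∈L , proper) = lose (∈-vectors (tabulate f) (λ i → ∈-allFin _))
    ( (λ x → subst (_∈ L x) (sym (lookup∘tabulate f x)) (f∈L x))
    , (λ x y x~y → subst₂ _≢_ (sym (lookup∘tabulate f x)) (sym (lookup∘tabulate f y))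
                     (proper x y x~y)))

subsetsOfSize : (c s : ℕ) → List (Subset s)
subsetsOfSize c s = filter (λ p → ∣ p ∣ ℕ.≟ c) (vectors (inside ∷ outside ∷ []) s)

-- The sample space.  Choosing the lists of the n vertices independently and
-- uniformly is choosing one of these n-tuples uniformly.
listAssignments : (n c s : ℕ) → List (Vec (Subset s) n)
listAssignments n c s = vectors (subsetsOfSize c s) n

subsetOfSize : ∀ {c s} → c ≤ s → ∃ λ (p : Subset s) → ∣ p ∣ ≡ c
subsetOfSize {s = s} z≤n = ⊥ , ∣⊥∣≡0 s
subsetOfSize (s≤s c≤s)   = let p , ∣p∣≡c = subsetOfSize c≤s in inside ∷ p , cong suc ∣p∣≡c

listAssignments-nonEmpty : ∀ n {c s} → c ≤ s → NonZero (length (listAssignments n c s))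
listAssignments-nonEmpty n {c} {s} c≤s = >-nonZero (∈-length
  (∈-vectors (tabulate {n = n} (λ _ → proj₁ p))
    (λ i → subst (_∈ˡ subsetsOfSize c s) (sym (lookup∘tabulate (λ _ → proj₁ p) i)) p∈)))
  where
  p = subsetOfSize c≤s

  side∈ : (b : Bool) → b ∈ˡ (inside ∷ outside ∷ [])
  side∈ true  = here refl
  side∈ false = there (here refl)

  p∈ : proj₁ p ∈ˡ subsetsOfSize c s
  p∈ = ∈-filter⁺ (λ q → ∣ q ∣ ℕ.≟ c)
         (∈-vectors (proj₁ p) (λ i → side∈ (lookup (proj₁ p) i))) (proj₂ p)

-- The colours are the elements of Fin s.  The condition c ≤ s says that there
-- are lists to draw from.
p : (n c k s : ℕ) → .(c ≤ s) → ℚ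
p n c k s c≤s = probability (listAssignments n c s)
  {{listAssignments-nonEmpty n c≤s}}
  (λ L → colourable? (cyclePower? n k) (lookup L))

-- Convergence of a rational sequence to a rational limit; rational ε suffice.
TendsTo : (ℕ → ℚ) → ℚ → Set
TendsTo a l = ∀ ε → 0ℚ ℚ.< ε → ∃ λ N → ∀ n → N ≤ n → ℚ.∣ a n ℚ.- l ∣ ℚ.< ε

{-# OPTIONS --safe #-}
-- Lists of size at least k + 1 let one colour greedily along the cycle, so only closing up can
-- fail.  It cannot fail when some m = (k + 3)(k + 1) consecutive vertices carry suitable lists, and
-- m fixed vertices do so with probability at least 1 / (d + 1) for a d that does not depend on s.
-- Hence, for n ≥ q m, the probability of failure is at most (d / (d + 1)) ^ q ≤ d / (d + q).
--
-- For large s, suitable means that the first k + 1 lists are disjoint from the other ones; random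
-- lists of size c avoid a bounded set of colours with probability at least 2 ^ (- c).
--
-- For bounded s, one fixed pattern of lists is used.  Fix k + 1 colours κ and a further colour ⋆,
-- and cut the m vertices into rounds of k + 1.  The lists contain all of κ, except that the list at
-- position r of round r + 1 contains ⋆ instead.  Round 0, coloured greedily from κ, is an arbitrary
-- permutation of κ; the ⋆ in round r + 1 makes room for swapping the entry at position r with any
-- later one.  So the permutation can be sorted, as in selection sort, and then agrees with the
-- colours κ given in advance to the last round, from where the greedy colouring started.
module Submission where

open import Data.Bool.Base using (Bool; true; false; if_then_else_)
import Data.Bool.Properties as Bool
open import Data.Fin.Base as Fin using (Fin; zero; suc; toℕ; fromℕ; fromℕ<; inject≤; combine; remQuot; _↑ˡ_; _↑ʳ_)
open import Data.Fin.Permutation.Components using (transpose; transpose-inverse)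
import Data.Fin.Properties as Fin
open import Data.Fin.Subset using (Subset; inside; outside; ∣_∣; ⊤; ⊥; _∈_; _∉_; _∪_)
open import Data.Fin.Subset.Properties using (_∈?_; ∈⊤; ∣⊤∣≡n; ∣⊥∣≡0; ∣p∣≤n; p⊆p∪q; q⊆p∪q)
import Data.Integer.Base as ℤ
open import Data.Integer.Divisibility.Signed using (divides)
import Data.Integer.Properties as ℤ
open import Data.List.Base using (List; []; _∷_; _++_; map; length; filter; cartesianProductWith)
open import Data.List.Membership.Propositional using () renaming (_∈_ to _∈ˡ_)
open import Data.List.Membership.Propositional.Properties
  using (∈-filter⁺; ∈-filter⁻; ∈-cartesianProductWith⁻)
open import Data.List.Properties using (map-++; map-∘; length-++; length-map; length-filter)
open import Data.List.Relation.Unary.Any using (here; there)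
open import Data.Nat.Base
open import Data.Nat.Combinatorics using (_C_; nCk+nC[k+1]≡[n+1]C[k+1]; k>n⇒nCk≡0)
open import Data.Nat.DivMod
  using (_%_; _mod_; m%n<n; m<n⇒m%n≡m; m%n%n≡m%n; [m+n]%n≡m%n; [m+kn]%n≡m%n; %-distribˡ-+)
open import Data.Nat.ListAction using (sum)
open import Data.Nat.ListAction.Properties using (sum-++)
open import Data.Nat.Properties
open import Data.Nat.Tactic.RingSolver using (solve-∀)
open import Data.Product.Base using (∃; _×_; _,_; proj₁; proj₂; uncurry)
open import Data.Rational.Base as ℚ using (mkℚ; 0ℚ; 1ℚ)
import Data.Rational.Properties as ℚ
open import Data.Rational.Unnormalised.Base as ℚᵘ using (mkℚᵘ; *≡*; *<*)
import Data.Rational.Unnormalised.Properties as ℚᵘ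
open import Data.Sum.Base using (_⊎_; inj₁; inj₂)
open import Data.Vec.Base as Vec using (Vec; []; _∷_; lookup; tabulate; here; there)
open import Data.Vec.Properties using (lookup-++ˡ; lookup-++ʳ; lookup∘tabulate; ≡-dec)
open import Data.Vec.Relation.Unary.All using (All; []; _∷_; all?)
open import Data.Vec.Relation.Unary.All.Properties using (++⁺; lookup⁺)
open import Function.Base using (_∘_)
open import Function.Definitions using (Injective)
open import Level using (0ℓ)
open import Relation.Binary.Definitions using (tri<; tri≈; tri>)
open import Relation.Binary.PropositionalEquality
open import Relation.Nullary.Decidable
  using (Dec; yes; no; does; ¬?; dec-true; dec-false; decidable-stable; _→-dec_)
open import Relation.Nullary.Negation using (¬_; contradiction)
open import Relation.Unary using (Pred; Decidable)
open import Defs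

private variable
  A B Z : Set

-- Sums over lists and windows of random vectors

𝟙 : {P : Set} → Dec P → ℕ
𝟙 P? = if does P? then 1 else 0

𝟙-mono : {P Q : Set} {P? : Dec P} {Q? : Dec Q} → (P → Q) → 𝟙 P? ≤ 𝟙 Q?
𝟙-mono {P? = no  _} {Q?}     _ = z≤n
𝟙-mono {P? = yes p} {yes _}  _ = ≤-refl
𝟙-mono {P? = yes p} {no ¬q}  f = contradiction (f p) ¬q

𝟙-true : {P : Set} {P? : Dec P} → P → 𝟙 P? ≡ 1
𝟙-true {P? = P?} p rewrite dec-true P? p = refl

𝟙-false : {P : Set} {P? : Dec P} → ¬ P → 𝟙 P? ≡ 0
𝟙-false {P? = P?} ¬p rewrite dec-false P? ¬p = refl

𝟙-¬ : {P : Set} (P? : Dec P) → 𝟙 (¬? P?) + 𝟙 P? ≡ 1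
𝟙-¬ (yes _) = refl
𝟙-¬ (no _)  = refl

∑ : List A → (A → ℕ) → ℕ
∑ xs φ = sum (map φ xs)

∑-++ : ∀ (xs ys : List A) φ → ∑ (xs ++ ys) φ ≡ ∑ xs φ + ∑ ys φ
∑-++ xs ys φ = trans (cong sum (map-++ φ xs ys)) (sum-++ (map φ xs) (map φ ys))

∑-mono : ∀ {xs : List A} {φ ψ} → (∀ {x} → x ∈ˡ xs → φ x ≤ ψ x) → ∑ xs φ ≤ ∑ xs ψ
∑-mono {xs = []}     h = z≤n
∑-mono {xs = x ∷ xs} h = +-mono-≤ (h (here refl)) (∑-mono {xs = xs} (h ∘ there))

∑-cong : ∀ {xs : List A} {φ ψ} → (∀ x → φ x ≡ ψ x) → ∑ xs φ ≡ ∑ xs ψ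
∑-cong {xs = []}     h = refl
∑-cong {xs = x ∷ xs} h = cong₂ _+_ (h x) (∑-cong {xs = xs} h)

∑-+ : ∀ (xs : List A) φ ψ → ∑ xs (λ x → φ x + ψ x) ≡ ∑ xs φ + ∑ xs ψ
∑-+ []       φ ψ = refl
∑-+ (x ∷ xs) φ ψ rewrite ∑-+ xs φ ψ = +-interchange (φ x) (ψ x) (∑ xs φ) (∑ xs ψ)
  where
  +-interchange : ∀ a b c d → (a + b) + (c + d) ≡ (a + c) + (b + d)
  +-interchange = solve-∀

∑-*ˡ : ∀ a (xs : List A) φ → ∑ xs (λ x → a * φ x) ≡ a * ∑ xs φ
∑-*ˡ a []       φ = sym (*-zeroʳ a)
∑-*ˡ a (x ∷ xs) φ rewrite ∑-*ˡ a xs φ = sym (*-distribˡ-+ a (φ x) (∑ xs φ))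

∑-*ʳ : ∀ a (xs : List A) φ → ∑ xs (λ x → φ x * a) ≡ ∑ xs φ * a
∑-*ʳ a xs φ = trans (∑-cong {xs = xs} (λ x → *-comm (φ x) a)) (trans (∑-*ˡ a xs φ) (*-comm a _))

∑-1 : ∀ (xs : List A) → ∑ xs (λ _ → 1) ≡ length xs
∑-1 []       = refl
∑-1 (x ∷ xs) = cong suc (∑-1 xs)

∑-≥1 : ∀ {xs : List A} {x} φ → x ∈ˡ xs → 1 ≤ φ x → 1 ≤ ∑ xs φ
∑-≥1 φ (here refl) h = ≤-trans h (m≤m+n _ _)
∑-≥1 φ (there x∈)  h = ≤-trans (∑-≥1 φ x∈ h) (m≤n+m _ _)

∑-filter : {P : Pred A 0ℓ} (P? : Decidable P) (xs : List A) (φ : A → ℕ) →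
           ∑ (filter P? xs) φ ≡ ∑ xs (λ x → 𝟙 (P? x) * φ x)
∑-filter P? []       φ = refl
∑-filter P? (x ∷ xs) φ with does (P? x)
... | true  = cong₂ _+_ (sym (*-identityˡ (φ x))) (∑-filter P? xs φ)
... | false = ∑-filter P? xs φ

length-filter-∑ : {P : Pred A 0ℓ} (P? : Decidable P) (xs : List A) →
                  length (filter P? xs) ≡ ∑ xs (𝟙 ∘ P?)
length-filter-∑ P? xs = begin
  length (filter P? xs)      ≡⟨ ∑-1 (filter P? xs) ⟨
  ∑ (filter P? xs) (λ _ → 1) ≡⟨ ∑-filter P? xs _ ⟩
  ∑ xs (λ x → 𝟙 (P? x) * 1)  ≡⟨ ∑-cong {xs = xs} (λ x → *-identityʳ _) ⟩
  ∑ xs (𝟙 ∘ P?)              ∎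
  where open ≡-Reasoning

∑-complement : {P : Pred A 0ℓ} (P? : Decidable P) (xs : List A) →
               ∑ xs (𝟙 ∘ ¬? ∘ P?) + ∑ xs (𝟙 ∘ P?) ≡ length xs
∑-complement P? xs = begin
  ∑ xs (𝟙 ∘ ¬? ∘ P?) + ∑ xs (𝟙 ∘ P?)   ≡⟨ ∑-+ xs _ _ ⟨
  ∑ xs (λ x → 𝟙 (¬? (P? x)) + 𝟙 (P? x)) ≡⟨ ∑-cong {xs = xs} (𝟙-¬ ∘ P?) ⟩
  ∑ xs (λ _ → 1)                        ≡⟨ ∑-1 xs ⟩
  length xs                             ∎
  where open ≡-Reasoning

∑-cartesianProductWith : ∀ (f : A → B → Z) xs ys φ →
  ∑ (cartesianProductWith f xs ys) φ ≡ ∑ xs (λ x → ∑ ys (λ y → φ (f x y)))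
∑-cartesianProductWith f []       ys φ = refl
∑-cartesianProductWith f (x ∷ xs) ys φ = trans
  (∑-++ (map (f x) ys) (cartesianProductWith f xs ys) φ)
  (cong₂ _+_ (cong sum (sym (map-∘ ys))) (∑-cartesianProductWith f xs ys φ))

vectors-All : ∀ {X : List A} n {v} → v ∈ˡ vectors X n → All (_∈ˡ X) v
vectors-All zero    {[]} _ = []
vectors-All {X = X} (suc n) v∈
  with _ , _ , x∈ , w∈ , refl ← ∈-cartesianProductWith⁻ _∷_ X (vectors X n) v∈
  = x∈ ∷ vectors-All n w∈

length-cartesianProductWith : ∀ (f : A → B → Z) xs ys →
  length (cartesianProductWith f xs ys) ≡ length xs * length ys
length-cartesianProductWith f []       ys = refl
length-cartesianProductWith f (x ∷ xs) ys = trans (length-++ (map (f x) ys))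
  (cong₂ _+_ (length-map (f x) ys) (length-cartesianProductWith f xs ys))

length-vectors : ∀ (X : List A) n → length (vectors X n) ≡ length X ^ n
length-vectors X zero    = refl
length-vectors X (suc n) = trans (length-cartesianProductWith _∷_ X (vectors X n))
  (cong (length X *_) (length-vectors X n))

∑-vectors-++ : ∀ (X : List A) m n (φ : Vec A (m + n) → ℕ) →
  ∑ (vectors X (m + n)) φ ≡ ∑ (vectors X m) (λ u → ∑ (vectors X n) (λ v → φ (u Vec.++ v)))
∑-vectors-++ X zero    n φ = sym (+-identityʳ _)
∑-vectors-++ X (suc m) n φ = begin
  ∑ (vectors X (suc m + n)) φ
    ≡⟨ ∑-cartesianProductWith _∷_ X (vectors X (m + n)) φ ⟩
  ∑ X (λ x → ∑ (vectors X (m + n)) (λ w → φ (x ∷ w)))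
    ≡⟨ ∑-cong {xs = X} (λ x → ∑-vectors-++ X m n (φ ∘ (x ∷_))) ⟩
  ∑ X (λ x → ∑ (vectors X m) (λ u → ∑ (vectors X n) (λ v → φ (x ∷ u Vec.++ v))))
    ≡⟨ ∑-cartesianProductWith _∷_ X (vectors X m) _ ⟨
  ∑ (vectors X (suc m)) (λ u → ∑ (vectors X n) (λ v → φ (u Vec.++ v))) ∎
  where open ≡-Reasoning

𝟙-all? : {P : Pred A 0ℓ} (P? : Decidable P) {n : ℕ} (x : A) (v : Vec A n) →
         𝟙 (all? P? (x ∷ v)) ≡ 𝟙 (P? x) * 𝟙 (all? P? v)
𝟙-all? P? x v with does (P? x)
... | true  = sym (*-identityˡ _)
... | false = refl

-- The product rule for independent entries, in counting form.
∑-all? : ∀ (X : List A) {P : Pred A 0ℓ} (P? : Decidable P) n →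
         ∑ (vectors X n) (𝟙 ∘ all? P?) ≡ ∑ X (𝟙 ∘ P?) ^ n
∑-all? X P? zero    = refl
∑-all? X P? (suc n) = begin
  ∑ (vectors X (suc n)) (𝟙 ∘ all? P?)
    ≡⟨ ∑-cartesianProductWith _∷_ X (vectors X n) _ ⟩
  ∑ X (λ x → ∑ (vectors X n) (λ v → 𝟙 (all? P? (x ∷ v))))
    ≡⟨ ∑-cong {xs = X} (λ x → trans (∑-cong {xs = vectors X n} (𝟙-all? P? x))
                                    (∑-*ˡ (𝟙 (P? x)) (vectors X n) _)) ⟩
  ∑ X (λ x → 𝟙 (P? x) * ∑ (vectors X n) (𝟙 ∘ all? P?))
    ≡⟨ ∑-*ʳ _ X _ ⟩
  ∑ X (𝟙 ∘ P?) * ∑ (vectors X n) (𝟙 ∘ all? P?)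
    ≡⟨ cong (∑ X (𝟙 ∘ P?) *_) (∑-all? X P? n) ⟩
  ∑ X (𝟙 ∘ P?) ^ suc n ∎
  where open ≡-Reasoning

-- Positions are compared as natural numbers, which suits both prefixing and reduction modulo the
-- length. The bound rules out a `b` that overhangs the end of `v`, as its overhanging entries would
-- be left unconstrained by the second component.
Window : ∀ {m n} → Vec A m → ℕ → Vec A n → Set
Window {m = m} {n} b t v = t + m ≤ n ×
  (∀ i j → toℕ j ≡ t + toℕ i → lookup v j ≡ lookup b i)

window-++ˡ : ∀ {m n} (b : Vec A m) (v : Vec A n) → Window b 0 (b Vec.++ v)
window-++ˡ {m = m} {n} b v = m≤m+n m n , λ i j j≡i →
  trans (cong (lookup (b Vec.++ v)) (Fin.toℕ-injective (trans j≡i (sym (Fin.toℕ-↑ˡ i n)))))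
        (lookup-++ˡ b v i)

window-++ʳ : ∀ {l m n} {b : Vec A m} {t} (u : Vec A l) {v : Vec A n} →
             Window b t v → Window b (l + t) (u Vec.++ v)
window-++ʳ {l = l} {m} {n} {b} {t} u {v} (t+m≤n , h) =
  ≤-trans (≤-reflexive (+-assoc l t m)) (+-monoʳ-≤ l t+m≤n) , λ i j j≡ →
  let t+i<n = <-≤-trans (+-monoʳ-< t (Fin.toℕ<n i)) t+m≤n
      j′ = Fin.fromℕ< t+i<n
      j′≡ = Fin.toℕ-fromℕ< t+i<n
  in trans (cong (lookup (u Vec.++ v)) (Fin.toℕ-injective
             (trans j≡ (trans (+-assoc l t (toℕ i))
               (trans (cong (l +_) (sym j′≡)) (sym (Fin.toℕ-↑ʳ l j′)))))))
     (trans (lookup-++ʳ u v j′) (h i j′ j′≡))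

module _ (X : List A) {m : ℕ} {Good : Pred (Vec A m) 0ℓ} (Good? : Decidable Good) (d : ℕ)
         (good-share : length X ^ m ≤ suc d * ∑ (vectors X m) (𝟙 ∘ Good?)) where

  private
    N = length X

  bad-share : suc d * ∑ (vectors X m) (𝟙 ∘ ¬? ∘ Good?) ≤ d * N ^ m
  bad-share = +-cancelʳ-≤ (N ^ m) _ _ (begin
    suc d * bad + N ^ m        ≤⟨ +-monoʳ-≤ (suc d * bad) good-share ⟩
    suc d * bad + suc d * good ≡⟨ *-distribˡ-+ (suc d) bad good ⟨
    suc d * (bad + good)       ≡⟨ cong (suc d *_) (trans (∑-complement Good? (vectors X m))
                                                         (length-vectors X m)) ⟩
    suc d * N ^ m              ≡⟨ +-comm (N ^ m) _ ⟩
    d * N ^ m + N ^ m          ∎)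
    where
    open ≤-Reasoning
    good = ∑ (vectors X m) (𝟙 ∘ Good?)
    bad  = ∑ (vectors X m) (𝟙 ∘ ¬? ∘ Good?)

  private
    -- The window may start anywhere, so the condition passes from `P` to `P ∘ (u Vec.++_)`, as the
    -- induction on blocks requires.
    ImpliedByWindow : ∀ {n} → Pred (Vec A n) 0ℓ → Set
    ImpliedByWindow P = ∀ {b t v} → All (_∈ˡ X) v → Good b → Window b t v → P v

  -- Disjoint blocks of length `m` are inspected from the front. A good first block already forces
  -- `P`. So failures come only from bad first blocks, a share of at most d / (d + 1), and each of
  -- these leaves the same problem with one block fewer.
  avoidance : ∀ q {n} → q * m ≤ n → {P : Pred (Vec A n) 0ℓ} (P? : Decidable P) →
              ImpliedByWindow P →
              suc d ^ q * ∑ (vectors X n) (𝟙 ∘ ¬? ∘ P?) ≤ d ^ q * N ^ n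
  avoidance zero {n} _ P? good⇒P = *-monoʳ-≤ 1 (begin
    ∑ (vectors X n) (𝟙 ∘ ¬? ∘ P?)  ≤⟨ m≤m+n _ _ ⟩
    ∑ (vectors X n) (𝟙 ∘ ¬? ∘ P?) + ∑ (vectors X n) (𝟙 ∘ P?)
                                   ≡⟨ ∑-complement P? (vectors X n) ⟩
    length (vectors X n)           ≡⟨ length-vectors X n ⟩
    N ^ n                          ∎)
    where open ≤-Reasoning
  avoidance (suc q) {n} le P? good⇒P with m≤n⇒∃[o]m+o≡n (≤-trans (m≤m+n m (q * m)) le)
  ... | n′ , refl = begin
    suc d ^ suc q * ∑ (vectors X (m + n′)) (𝟙 ∘ ¬? ∘ P?)
      ≡⟨ cong (suc d ^ suc q *_) (∑-vectors-++ X m n′ _) ⟩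
    suc d ^ suc q * ∑ (vectors X m) rest
      ≡⟨ *-assoc (suc d) (suc d ^ q) _ ⟩
    suc d * (suc d ^ q * ∑ (vectors X m) rest)
      ≡⟨ cong (suc d *_) (∑-*ˡ (suc d ^ q) (vectors X m) rest) ⟨
    suc d * ∑ (vectors X m) (λ u → suc d ^ q * rest u)
      ≤⟨ *-monoʳ-≤ (suc d) (∑-mono {xs = vectors X m} rest-≤) ⟩
    suc d * ∑ (vectors X m) (λ u → 𝟙 (¬? (Good? u)) * (d ^ q * N ^ n′))
      ≡⟨ cong (suc d *_) (∑-*ʳ _ (vectors X m) _) ⟩
    suc d * (∑ (vectors X m) (𝟙 ∘ ¬? ∘ Good?) * (d ^ q * N ^ n′))
      ≡⟨ *-assoc (suc d) (∑ (vectors X m) (𝟙 ∘ ¬? ∘ Good?)) _ ⟨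
    suc d * ∑ (vectors X m) (𝟙 ∘ ¬? ∘ Good?) * (d ^ q * N ^ n′)
      ≤⟨ *-monoˡ-≤ _ bad-share ⟩
    d * N ^ m * (d ^ q * N ^ n′)
      ≡⟨ *-interchange d (N ^ m) (d ^ q) (N ^ n′) ⟩
    d ^ suc q * (N ^ m * N ^ n′)
      ≡⟨ cong (d ^ suc q *_) (^-distribˡ-+-* N m n′) ⟨
    d ^ suc q * N ^ (m + n′) ∎
    where
    open ≤-Reasoning
    rest : Vec A m → ℕ
    rest u = ∑ (vectors X n′) (λ v → 𝟙 (¬? (P? (u Vec.++ v))))

    *-interchange : ∀ a b c e → a * b * (c * e) ≡ a * c * (b * e)
    *-interchange = solve-∀

    rest-≤ : ∀ {u} → u ∈ˡ vectors X m → suc d ^ q * rest u ≤ 𝟙 (¬? (Good? u)) * (d ^ q * N ^ n′)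
    rest-≤ {u} u∈ with Good? u
    ... | no  _ = ≤-trans
      (avoidance q (+-cancelˡ-≤ m _ _ le) (P? ∘ (u Vec.++_))
        (λ {b} {t} v⊆X good → good⇒P {b} (++⁺ (vectors-All m u∈) v⊆X) good ∘ window-++ʳ {b = b} {t} u))
      (≤-reflexive (sym (*-identityˡ _)))
    ... | yes good = ≤-trans (*-monoʳ-≤ (suc d ^ q) rest≤0) (≤-reflexive (*-zeroʳ (suc d ^ q)))
      where
      rest≤0 : rest u ≤ 0
      rest≤0 = ≤-trans
        (∑-mono {xs = vectors X n′} {ψ = λ _ → 0 * 1} λ {v} v∈ → ≤-reflexive
          (𝟙-false {P? = ¬? (P? (u Vec.++ v))} (λ ¬p → ¬p (good⇒P
            (++⁺ (vectors-All m u∈) (vectors-All n′ v∈)) good (window-++ˡ u v)))))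
        (≤-reflexive (∑-*ˡ 0 (vectors X n′) (λ _ → 1)))

-- Decay of the failure probability

-- Bernoulli's inequality 1 + q / d ≤ (1 + 1 / d) ^ q, cleared of denominators.
bernoulli : ∀ d q → d ^ q * (d + q) ≤ d * suc d ^ q
bernoulli d zero    = ≤-reflexive (trans (*-identityˡ (d + 0)) (trans (+-identityʳ d) (sym (*-identityʳ d))))
bernoulli d (suc q) = begin
  d * d ^ q * (d + suc q)           ≡⟨ lhs d (d ^ q) q ⟩
  d * (d ^ q * (d + q)) + d * d ^ q ≤⟨ +-mono-≤ (*-monoʳ-≤ d (bernoulli d q))
                                                (*-monoʳ-≤ d (^-monoˡ-≤ q (n≤1+n d))) ⟩
  d * (d * suc d ^ q) + d * suc d ^ q ≡⟨ rhs d (suc d ^ q) ⟩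
  d * suc d ^ suc q                 ∎
  where
  open ≤-Reasoning
  lhs : ∀ d x q → d * x * (d + suc q) ≡ d * (x * (d + q)) + d * x
  lhs = solve-∀
  rhs : ∀ d y → d * (d * y) + d * y ≡ d * (suc d * y)
  rhs = solve-∀

-- Trades the exponential bound on `a / t` for the weaker d / (d + q), so that a `q` suited to a
-- given ε can be written down without logarithms.
geometric-decay : ∀ d q {a t} → suc d ^ q * a ≤ d ^ q * t → (d + q) * a ≤ d * t
geometric-decay d q {a} {t} h = *-cancelˡ-≤ (suc d ^ q) {{m^n≢0 (suc d) q}} (begin
  suc d ^ q * ((d + q) * a) ≡⟨ swap (suc d ^ q) (d + q) a ⟩
  suc d ^ q * a * (d + q)   ≤⟨ *-monoˡ-≤ (d + q) h ⟩
  d ^ q * t * (d + q)       ≡⟨ swap′ (d ^ q) t (d + q) ⟩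
  d ^ q * (d + q) * t       ≤⟨ *-monoˡ-≤ t (bernoulli d q) ⟩
  d * suc d ^ q * t         ≡⟨ swap″ d (suc d ^ q) t ⟩
  suc d ^ q * (d * t)       ∎)
  where
  open ≤-Reasoning
  swap : ∀ x y z → x * (y * z) ≡ x * z * y
  swap = solve-∀
  swap′ : ∀ x y z → x * y * z ≡ x * z * y
  swap′ = solve-∀
  swap″ : ∀ x y z → x * y * z ≡ y * (x * z)
  swap″ = solve-∀

-- If t ≤ a * e, then (d + q) * a ≤ d * a * e, which by d * e < q forces a = 0 and hence t = 0.
small-ratio : ∀ {d q a t} e .{{_ : NonZero t}} → (d + q) * a ≤ d * t → d * e < q → a * e < t
small-ratio {d} {q} {a} {t} e h de<q = ≰⇒> λ t≤ae → 
  let a≡0 = m+n≤m⇒n≡0 (d * (a * e)) (begin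
        d * (a * e) + a ≡⟨ rearrange d a e ⟩
        suc (d * e) * a ≤⟨ *-monoˡ-≤ a (≤-trans de<q (m≤n+m q d)) ⟩
        (d + q) * a     ≤⟨ h ⟩
        d * t           ≤⟨ *-monoʳ-≤ d t≤ae ⟩
        d * (a * e)     ∎)
  in contradiction (n≤0⇒n≡0 (≤-trans t≤ae (≤-reflexive (cong (_* e) a≡0)))) (≢-nonZero⁻¹ t)
  where
  open ≤-Reasoning
  rearrange : ∀ d a e → d * (a * e) + a ≡ suc (d * e) * a
  rearrange = solve-∀
  m+n≤m⇒n≡0 : ∀ m {n} → m + n ≤ m → n ≡ 0
  m+n≤m⇒n≡0 m {n} h = n≤0⇒n≡0 (+-cancelˡ-≤ m n 0 (≤-trans h (≤-reflexive (sym (+-identityʳ m)))))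

-- Rational probabilities

toℚᵘ-/ : ∀ i t → ℚ.toℚᵘ (i ℚ./ suc t) ℚᵘ.≃ mkℚᵘ i t
toℚᵘ-/ i t = ℚ.toℚᵘ-fromℚᵘ (mkℚᵘ i t)

/-distribʳ-+ : ∀ a b t .{{_ : NonZero t}} → (ℤ.+ a ℚ./ t) ℚ.+ (ℤ.+ b ℚ./ t) ≡ ℤ.+ (a + b) ℚ./ t
/-distribʳ-+ a b (suc t) = ℚ.toℚᵘ-injective (begin
  ℚ.toℚᵘ (ℤ.+ a ℚ./ suc t ℚ.+ ℤ.+ b ℚ./ suc t)
    ≈⟨ ℚ.toℚᵘ-homo-+ (ℤ.+ a ℚ./ suc t) (ℤ.+ b ℚ./ suc t) ⟩
  ℚ.toℚᵘ (ℤ.+ a ℚ./ suc t) ℚᵘ.+ ℚ.toℚᵘ (ℤ.+ b ℚ./ suc t)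
    ≈⟨ ℚᵘ.+-cong (toℚᵘ-/ (ℤ.+ a) t) (toℚᵘ-/ (ℤ.+ b) t) ⟩
  mkℚᵘ (ℤ.+ a) t ℚᵘ.+ mkℚᵘ (ℤ.+ b) t
    ≈⟨ *≡* (trans (cong (ℤ._* T) (sym (ℤ.*-distribʳ-+ T (ℤ.+ a) (ℤ.+ b))))
                 (ℤ.*-assoc (ℤ.+ (a + b)) T T)) ⟩
  mkℚᵘ (ℤ.+ (a + b)) t
    ≈⟨ toℚᵘ-/ (ℤ.+ (a + b)) t ⟨
  ℚ.toℚᵘ (ℤ.+ (a + b) ℚ./ suc t) ∎)
  where
  open ℚᵘ.≃-Reasoning
  T = ℤ.+ suc t

n/n≡1 : ∀ t .{{_ : NonZero t}} → ℤ.+ t ℚ./ t ≡ 1ℚ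
n/n≡1 (suc t) = ℚ.toℚᵘ-injective (ℚᵘ.≃-trans (toℚᵘ-/ (ℤ.+ suc t) t)
  (*≡* (ℤ.*-comm (ℤ.+ suc t) (ℤ.+ 1))))

distance-to-1 : ∀ {a b t} .{{_ : NonZero t}} → b + a ≡ t → ℚ.∣ ℤ.+ a ℚ./ t ℚ.- 1ℚ ∣ ≡ ℤ.+ b ℚ./ t
distance-to-1 {a} {b} {t} refl = begin
  -- Here 1 is written as β + α, after which α cancels.
  ℚ.∣ α ℚ.- 1ℚ ∣             ≡⟨ cong (λ x → ℚ.∣ α ℚ.- x ∣) (trans (/-distribʳ-+ b a t) (n/n≡1 t)) ⟨
  ℚ.∣ α ℚ.- (β ℚ.+ α) ∣      ≡⟨ cong (λ x → ℚ.∣ α ℚ.+ x ∣)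
                                  (trans (ℚ.neg-distrib-+ β α) (ℚ.+-comm (ℚ.- β) (ℚ.- α))) ⟩
  ℚ.∣ α ℚ.+ (ℚ.- α ℚ.- β) ∣  ≡⟨ cong ℚ.∣_∣ (ℚ.+-assoc α (ℚ.- α) (ℚ.- β)) ⟨
  ℚ.∣ α ℚ.- α ℚ.- β ∣        ≡⟨ cong (λ x → ℚ.∣ x ℚ.- β ∣) (ℚ.+-inverseʳ α) ⟩
  ℚ.∣ 0ℚ ℚ.- β ∣             ≡⟨ cong ℚ.∣_∣ (ℚ.+-identityˡ (ℚ.- β)) ⟩
  ℚ.∣ ℚ.- β ∣                ≡⟨ ℚ.∣-p∣≡∣p∣ β ⟩
  ℚ.∣ β ∣                    ≡⟨ ℚ.0≤p⇒∣p∣≡p (ℚ.nonNegative⁻¹ β {{ℚ.normalize-nonNeg b t}}) ⟩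
  β                          ∎
  where
  open ≡-Reasoning
  α = ℤ.+ a ℚ./ t
  β = ℤ.+ b ℚ./ t

-- A positive ε has numerator at least 1, so it is at least the reciprocal of its denominator, and b
-- / t lies below that reciprocal.
ratio-< : ∀ b {t} .{{_ : NonZero t}} ε → 0ℚ ℚ.< ε → b * ℚ.↧ₙ ε < t → ℤ.+ b ℚ./ t ℚ.< ε
ratio-< b {suc t} ε@(mkℚ ℤ.+[1+ x ] e _) 0<ε h = ℚ.toℚᵘ-cancel-<
  (ℚᵘ.<-respˡ-≃ (ℚᵘ.≃-sym (toℚᵘ-/ (ℤ.+ b) t))
    (*<* (subst₂ ℤ._<_ (ℤ.pos-* b (suc e)) (ℤ.pos-* (suc x) (suc t))
      (ℤ.+<+ (<-≤-trans h (m≤n*m (suc t) (suc x)))))))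
ratio-< b (mkℚ (ℤ.+ zero) e _) (ℚ.*<* (ℤ.+<+ ())) h
ratio-< b (mkℚ (ℤ.-[1+ x ]) e _) (ℚ.*<* ()) h

probability-near-1 : ∀ {A : Set} (xs : List A) .{{_ : NonZero (length xs)}} {P : Pred A 0ℓ}
  (P? : Decidable P) ε → 0ℚ ℚ.< ε → ∑ xs (𝟙 ∘ ¬? ∘ P?) * ℚ.↧ₙ ε < length xs →
  ℚ.∣ probability xs P? ℚ.- 1ℚ ∣ ℚ.< ε
probability-near-1 xs P? ε 0<ε h = subst (ℚ._< ε)
  (sym (distance-to-1 {length (filter P? xs)} {∑ xs (𝟙 ∘ ¬? ∘ P?)} (trans
    (cong (∑ xs (𝟙 ∘ ¬? ∘ P?) +_) (length-filter-∑ P? xs)) (∑-complement P? xs))))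
  (ratio-< (∑ xs (𝟙 ∘ ¬? ∘ P?)) ε 0<ε h)

-- Counting subsets

[m*n]^o≡m^o*n^o : ∀ m n o → (m * n) ^ o ≡ m ^ o * n ^ o
[m*n]^o≡m^o*n^o m n zero    = refl
[m*n]^o≡m^o*n^o m n (suc o) =
  trans (cong (m * n *_) ([m*n]^o≡m^o*n^o m n o)) ([m*n]*[o*p]≡[m*o]*[n*p] m n (m ^ o) (n ^ o))

-- The absorption identity, derived from Pascal's rule so that it also covers k > n.
[k+1]*[n+1]C[k+1]≡[n+1]*nCk : ∀ n k → suc k * (suc n C suc k) ≡ suc n * (n C k)
[k+1]*[n+1]C[k+1]≡[n+1]*nCk zero    zero    = refl
[k+1]*[n+1]C[k+1]≡[n+1]*nCk zero    (suc k) =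
  trans (cong (suc (suc k) *_) (k>n⇒nCk≡0 {1} {suc (suc k)} (s≤s (s≤s z≤n))))
    (trans (*-zeroʳ (suc (suc k))) (cong (1 *_) (sym (k>n⇒nCk≡0 {0} {suc k} (s≤s z≤n)))))
[k+1]*[n+1]C[k+1]≡[n+1]*nCk (suc n) zero    = begin
  1 * (suc (suc n) C 1)        ≡⟨ cong (1 *_) (nCk+nC[k+1]≡[n+1]C[k+1] (suc n) 0) ⟨
  1 * (1 + suc n C 1)          ≡⟨ rearrange (suc n C 1) ⟩
  1 + 1 * (suc n C 1)          ≡⟨ cong (1 +_) ([k+1]*[n+1]C[k+1]≡[n+1]*nCk n 0) ⟩
  suc (suc n) * 1              ∎
  where
  open ≡-Reasoning
  rearrange : ∀ x → 1 * (1 + x) ≡ 1 + 1 * x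
  rearrange = solve-∀
[k+1]*[n+1]C[k+1]≡[n+1]*nCk (suc n) (suc k) = begin
  suc (suc k) * (suc (suc n) C suc (suc k))
    ≡⟨ cong (suc (suc k) *_) (nCk+nC[k+1]≡[n+1]C[k+1] (suc n) (suc k)) ⟨
  suc (suc k) * (suc n C suc k + suc n C suc (suc k))
    ≡⟨ rearrange (suc k) (suc n C suc k) (suc n C suc (suc k)) ⟩
  suc n C suc k + (suc k * (suc n C suc k) + suc (suc k) * (suc n C suc (suc k)))
    ≡⟨ cong (suc n C suc k +_) (cong₂ _+_ ([k+1]*[n+1]C[k+1]≡[n+1]*nCk n k)
                                          ([k+1]*[n+1]C[k+1]≡[n+1]*nCk n (suc k))) ⟩
  suc n C suc k + (suc n * (n C k) + suc n * (n C suc k))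
    ≡⟨ cong (suc n C suc k +_) (*-distribˡ-+ (suc n) (n C k) (n C suc k)) ⟨
  suc n C suc k + suc n * (n C k + n C suc k)
    ≡⟨ cong (λ x → suc n C suc k + suc n * x) (nCk+nC[k+1]≡[n+1]C[k+1] n k) ⟩
  suc (suc n) * (suc n C suc k) ∎
  where
  open ≡-Reasoning
  rearrange : ∀ k x y → suc k * (x + y) ≡ x + (k * x + suc k * y)
  rearrange = solve-∀

-- The factors (t + r - i) / (r - i) of the quotient of the two sides are at most 2.
[t+r]Cc≤2^c*rCc : ∀ t c {r} → t + c ≤ r → (t + r) C c ≤ 2 ^ c * (r C c)
[t+r]Cc≤2^c*rCc t zero    _ = ≤-refl
[t+r]Cc≤2^c*rCc t (suc c) {zero} le =
  contradiction (≤-trans (m≤n+m (suc c) t) le) λ ()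
[t+r]Cc≤2^c*rCc t (suc c) {suc r} le = *-cancelˡ-≤ (suc c) (begin
  suc c * ((t + suc r) C suc c)      ≡⟨ cong (λ x → suc c * (x C suc c)) (+-suc t r) ⟩
  suc c * (suc (t + r) C suc c)      ≡⟨ [k+1]*[n+1]C[k+1]≡[n+1]*nCk (t + r) c ⟩
  suc (t + r) * ((t + r) C c)        ≤⟨ *-mono-≤ t+r≤ ([t+r]Cc≤2^c*rCc t c t+c≤r) ⟩
  2 * suc r * (2 ^ c * (r C c))      ≡⟨ rearrange 2 (suc r) (2 ^ c) (r C c) ⟩
  2 ^ suc c * (suc r * (r C c))      ≡⟨ cong (2 ^ suc c *_) ([k+1]*[n+1]C[k+1]≡[n+1]*nCk r c) ⟨
  2 ^ suc c * (suc c * (suc r C suc c)) ≡⟨ rearrange′ (2 ^ suc c) (suc c) (suc r C suc c) ⟩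
  suc c * (2 ^ suc c * (suc r C suc c)) ∎)
  where
  open ≤-Reasoning
  t+c≤r : t + c ≤ r
  t+c≤r = s≤s⁻¹ (≤-trans (≤-reflexive (sym (+-suc t c))) le)
  t+r≤ : suc (t + r) ≤ 2 * suc r
  t+r≤ = ≤-trans (≤-reflexive (sym (+-suc t r))) (+-mono-≤
    (≤-trans (m≤m+n t (suc c)) le) (≤-reflexive (sym (+-identityʳ (suc r)))))
  rearrange : ∀ a b c d → a * b * (c * d) ≡ a * c * (b * d)
  rearrange = solve-∀
  rearrange′ : ∀ a b c → a * (b * c) ≡ b * (a * c)
  rearrange′ = solve-∀

Sides : List Bool
Sides = inside ∷ outside ∷ []

∑-sides : ∀ s (φ : Subset (suc s) → ℕ) → ∑ (vectors Sides (suc s)) φ ≡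
  ∑ (vectors Sides s) (φ ∘ (inside ∷_)) + ∑ (vectors Sides s) (φ ∘ (outside ∷_))
∑-sides s φ = trans (∑-cartesianProductWith _∷_ Sides (vectors Sides s) φ)
  (cong (∑ (vectors Sides s) (φ ∘ (inside ∷_)) +_) (+-identityʳ _))

∑-zero : ∀ {A : Set} (xs : List A) → ∑ xs (λ _ → 0) ≡ 0
∑-zero xs = ∑-*ˡ 0 xs (λ _ → 1)

-- Pascal's rule, according to the side of the first colour.
∑-card : ∀ s c → ∑ (vectors Sides s) (λ p → 𝟙 (∣ p ∣ ≟ c)) ≡ s C c
∑-card zero    zero    = refl
∑-card zero    (suc c) = sym (k>n⇒nCk≡0 {0} {suc c} (s≤s z≤n))
∑-card (suc s) zero    = trans (∑-sides s _) (cong₂ _+_ (∑-zero (vectors Sides s)) (∑-card s zero))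
∑-card (suc s) (suc c) = begin
  ∑ (vectors Sides (suc s)) (λ p → 𝟙 (∣ p ∣ ≟ suc c)) ≡⟨ ∑-sides s _ ⟩
  _ ≡⟨ cong₂ _+_ (∑-card s c) (∑-card s (suc c)) ⟩
  s C c + s C suc c                                   ≡⟨ nCk+nC[k+1]≡[n+1]C[k+1] s c ⟩
  suc s C suc c                                       ∎
  where open ≡-Reasoning

length-subsetsOfSize : ∀ c s → length (subsetsOfSize c s) ≡ s C c
length-subsetsOfSize c s = trans (length-filter-∑ (λ p → ∣ p ∣ ≟ c) (vectors Sides s)) (∑-card s c)

length-subsetsOfSize-≤ : ∀ c s → length (subsetsOfSize c s) ≤ 2 ^ s
length-subsetsOfSize-≤ c s = ≤-trans (length-filter (λ p → ∣ p ∣ ≟ c) (vectors Sides s))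
  (≤-reflexive (length-vectors Sides s))

∈-subsetsOfSize⁻ : ∀ {c s} {p : Subset s} → p ∈ˡ subsetsOfSize c s → ∣ p ∣ ≡ c
∈-subsetsOfSize⁻ {c} {s} p∈ = proj₂ (∈-filter⁻ (λ p → ∣ p ∣ ≟ c) {xs = vectors Sides s} p∈)

∈-subsetsOfSize⁺ : ∀ {c s} {p : Subset s} → ∣ p ∣ ≡ c → p ∈ˡ subsetsOfSize c s
∈-subsetsOfSize⁺ {c} {p = p} ∣p∣≡c =
  ∈-filter⁺ (λ p → ∣ p ∣ ≟ c) (∈-vectors p (side∈ ∘ lookup p)) ∣p∣≡c
  where
  side∈ : ∀ b → b ∈ˡ Sides
  side∈ true  = here refl
  side∈ false = there (here refl)

-- Random lists that avoid given colours

Disjoint : ∀ {s} → Subset s → Subset s → Set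
Disjoint U p = ∀ x → x ∈ U → x ∉ p

disjoint? : ∀ {s} (U : Subset s) → Decidable (Disjoint U)
disjoint? U p = Fin.all? (λ x → (x ∈? U) →-dec ¬? (x ∈? p))

disjoint-out : ∀ {s} {U p : Subset s} {y} → Disjoint U p → Disjoint (outside ∷ U) (y ∷ p)
disjoint-out d (suc x) (there x∈U) (there x∈p) = d x x∈U x∈p

disjoint-in-out : ∀ {s} {U p : Subset s} → Disjoint U p → Disjoint (inside ∷ U) (outside ∷ p)
disjoint-in-out d (suc x) (there x∈U) (there x∈p) = d x x∈U x∈p

-- A colour of `U` has to stay outside `p`, while any other colour may go to either side and yields
-- the two terms of Pascal's rule.
∑-disjoint : ∀ {s} (U : Subset s) c → (s ∸ ∣ U ∣) C c ≤
  ∑ (vectors Sides s) (λ p → 𝟙 (∣ p ∣ ≟ c) * 𝟙 (disjoint? U p))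
∑-disjoint []            zero    = ≤-refl
∑-disjoint []            (suc c) = ≤-reflexive (k>n⇒nCk≡0 {0} {suc c} (s≤s z≤n))
∑-disjoint {suc s} (inside  ∷ U) c = begin
  (s ∸ ∣ U ∣) C c
    ≤⟨ ∑-disjoint U c ⟩
  ∑ (vectors Sides s) (λ p → 𝟙 (∣ p ∣ ≟ c) * 𝟙 (disjoint? U p))
    ≤⟨ ∑-mono {xs = vectors Sides s} (λ {p} _ → *-monoʳ-≤ (𝟙 (∣ p ∣ ≟ c))
         (𝟙-mono {P? = disjoint? U p} {disjoint? (inside ∷ U) (outside ∷ p)} disjoint-in-out)) ⟩
  ∑ (vectors Sides s) (λ p → 𝟙 (∣ p ∣ ≟ c) * 𝟙 (disjoint? (inside ∷ U) (outside ∷ p)))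
    ≤⟨ m≤n+m _ _ ⟩
  _ ≡⟨ ∑-sides s (λ p → 𝟙 (∣ p ∣ ≟ c) * 𝟙 (disjoint? (inside ∷ U) p)) ⟨
  ∑ (vectors Sides (suc s)) (λ p → 𝟙 (∣ p ∣ ≟ c) * 𝟙 (disjoint? (inside ∷ U) p)) ∎
  where open ≤-Reasoning
∑-disjoint {suc s} (outside ∷ U) zero = begin
  1
    ≤⟨ ∑-disjoint U zero ⟩
  ∑ (vectors Sides s) (λ p → 𝟙 (∣ p ∣ ≟ 0) * 𝟙 (disjoint? U p))
    ≤⟨ ∑-mono {xs = vectors Sides s} (λ {p} _ → *-monoʳ-≤ (𝟙 (∣ p ∣ ≟ 0))
         (𝟙-mono {P? = disjoint? U p} {disjoint? (outside ∷ U) (outside ∷ p)} disjoint-out)) ⟩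
  ∑ (vectors Sides s) (λ p → 𝟙 (∣ p ∣ ≟ 0) * 𝟙 (disjoint? (outside ∷ U) (outside ∷ p)))
    ≤⟨ m≤n+m _ _ ⟩
  _ ≡⟨ ∑-sides s (λ p → 𝟙 (∣ p ∣ ≟ 0) * 𝟙 (disjoint? (outside ∷ U) p)) ⟨
  ∑ (vectors Sides (suc s)) (λ p → 𝟙 (∣ p ∣ ≟ 0) * 𝟙 (disjoint? (outside ∷ U) p)) ∎
  where open ≤-Reasoning
∑-disjoint {suc s} (outside ∷ U) (suc c) = begin
  (suc s ∸ ∣ U ∣) C suc c
    ≡⟨ cong (_C suc c) (+-∸-assoc 1 (∣p∣≤n U)) ⟩
  suc (s ∸ ∣ U ∣) C suc c
    ≡⟨ nCk+nC[k+1]≡[n+1]C[k+1] (s ∸ ∣ U ∣) c ⟨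
  (s ∸ ∣ U ∣) C c + (s ∸ ∣ U ∣) C suc c
    ≤⟨ +-mono-≤ (∑-disjoint U c) (∑-disjoint U (suc c)) ⟩
  ∑ (vectors Sides s) (λ p → 𝟙 (∣ p ∣ ≟ c) * 𝟙 (disjoint? U p)) +
  ∑ (vectors Sides s) (λ p → 𝟙 (∣ p ∣ ≟ suc c) * 𝟙 (disjoint? U p))
    ≤⟨ +-mono-≤
         (∑-mono {xs = vectors Sides s} (λ {p} _ → *-monoʳ-≤ (𝟙 (∣ p ∣ ≟ c))
           (𝟙-mono {P? = disjoint? U p} {disjoint? (outside ∷ U) (inside ∷ p)} disjoint-out)))
         (∑-mono {xs = vectors Sides s} (λ {p} _ → *-monoʳ-≤ (𝟙 (∣ p ∣ ≟ suc c))
           (𝟙-mono {P? = disjoint? U p} {disjoint? (outside ∷ U) (outside ∷ p)} disjoint-out))) ⟩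
  _ ≡⟨ ∑-sides s (λ p → 𝟙 (∣ p ∣ ≟ suc c) * 𝟙 (disjoint? (outside ∷ U) p)) ⟨
  ∑ (vectors Sides (suc s)) (λ p → 𝟙 (∣ p ∣ ≟ suc c) * 𝟙 (disjoint? (outside ∷ U) p)) ∎
  where open ≤-Reasoning

-- Compares the binomial coefficients over all colours and over those outside `U`. The factor 2 ^ c
-- depends neither on `s` nor on `U`.
disjoint-share : ∀ {s} (U : Subset s) c → ∣ U ∣ + c ≤ s ∸ ∣ U ∣ →
  length (subsetsOfSize c s) ≤ 2 ^ c * ∑ (subsetsOfSize c s) (𝟙 ∘ disjoint? U)
disjoint-share {s} U c le = begin
  length (subsetsOfSize c s)           ≡⟨ length-subsetsOfSize c s ⟩
  s C c                                ≡⟨ cong (_C c) (m+[n∸m]≡n (∣p∣≤n U)) ⟨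
  (∣ U ∣ + (s ∸ ∣ U ∣)) C c            ≤⟨ [t+r]Cc≤2^c*rCc ∣ U ∣ c le ⟩
  2 ^ c * ((s ∸ ∣ U ∣) C c)            ≤⟨ *-monoʳ-≤ (2 ^ c) (∑-disjoint U c) ⟩
  2 ^ c * ∑ (vectors Sides s) (λ p → 𝟙 (∣ p ∣ ≟ c) * 𝟙 (disjoint? U p))
    ≡⟨ cong (2 ^ c *_) (∑-filter (λ p → ∣ p ∣ ≟ c) (vectors Sides s) _) ⟨
  2 ^ c * ∑ (subsetsOfSize c s) (𝟙 ∘ disjoint? U) ∎
  where open ≤-Reasoning

∣p∪q∣≤∣p∣+∣q∣ : ∀ {s} (p q : Subset s) → ∣ p ∪ q ∣ ≤ ∣ p ∣ + ∣ q ∣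
∣p∪q∣≤∣p∣+∣q∣ []            []            = z≤n
∣p∪q∣≤∣p∣+∣q∣ (inside  ∷ p) (inside  ∷ q) =
  s≤s (≤-trans (∣p∪q∣≤∣p∣+∣q∣ p q) (+-monoʳ-≤ ∣ p ∣ (n≤1+n ∣ q ∣)))
∣p∪q∣≤∣p∣+∣q∣ (inside  ∷ p) (outside ∷ q) = s≤s (∣p∪q∣≤∣p∣+∣q∣ p q)
∣p∪q∣≤∣p∣+∣q∣ (outside ∷ p) (inside  ∷ q) =
  ≤-trans (s≤s (∣p∪q∣≤∣p∣+∣q∣ p q)) (≤-reflexive (sym (+-suc ∣ p ∣ ∣ q ∣)))
∣p∪q∣≤∣p∣+∣q∣ (outside ∷ p) (outside ∷ q) = ∣p∪q∣≤∣p∣+∣q∣ p q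

⋃ : ∀ {s n} → Vec (Subset s) n → Subset s
⋃ []      = ⊥
⋃ (p ∷ v) = p ∪ ⋃ v

lookup⊆⋃ : ∀ {s n} (v : Vec (Subset s) n) i {x} → x ∈ lookup v i → x ∈ ⋃ v
lookup⊆⋃ (p ∷ v) zero    = p⊆p∪q (⋃ v)
lookup⊆⋃ (p ∷ v) (suc i) = q⊆p∪q p (⋃ v) ∘ lookup⊆⋃ v i

∣⋃∣≤n*c : ∀ {s c n} {v : Vec (Subset s) n} → All (_∈ˡ subsetsOfSize c s) v → ∣ ⋃ v ∣ ≤ n * c
∣⋃∣≤n*c {s}     []         = ≤-reflexive (∣⊥∣≡0 s)
∣⋃∣≤n*c {s} {c} {v = p ∷ v} (p∈ ∷ v⊆X) = ≤-trans (∣p∪q∣≤∣p∣+∣q∣ p (⋃ v))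
  (+-mono-≤ (≤-reflexive (∈-subsetsOfSize⁻ p∈)) (∣⋃∣≤n*c v⊆X))

Separated : ∀ {s} a {b} → Pred (Vec (Subset s) (a + b)) 0ℓ
Separated a {b} v = ∀ i j → Disjoint (lookup v (i ↑ˡ b)) (lookup v (a ↑ʳ j))

separated? : ∀ {s} a {b} → Decidable (Separated {s} a {b})
separated? a {b} v = Fin.all? (λ i → Fin.all? (λ j → disjoint? (lookup v (i ↑ˡ b)) (lookup v (a ↑ʳ j))))

separated-++ : ∀ {s a b} (u : Vec (Subset s) a) (v : Vec (Subset s) b) →
               All (Disjoint (⋃ u)) v → Separated a (u Vec.++ v)
separated-++ u v all i j rewrite lookup-++ˡ u v i | lookup-++ʳ u v j =
  λ x → lookup⁺ all j x ∘ lookup⊆⋃ u i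

-- With the first `a` lists fixed, their union has at most a * c colours, and each of the `b` later
-- lists avoids it independently with probability at least 2 ^ (- c).
separated-share : ∀ {s c} a b → a * c + (a * c + c) ≤ s →
  length (subsetsOfSize c s) ^ (a + b) ≤
  (2 ^ c) ^ b * ∑ (vectors (subsetsOfSize c s) (a + b)) (𝟙 ∘ separated? a)
separated-share {s} {c} a b le = begin
  N ^ (a + b)
    ≡⟨ ^-distribˡ-+-* N a b ⟩
  N ^ a * N ^ b
    ≡⟨ cong (_* N ^ b) (trans (sym (length-vectors X a)) (sym (∑-1 (vectors X a)))) ⟩
  ∑ (vectors X a) (λ _ → 1) * N ^ b
    ≡⟨ ∑-*ʳ (N ^ b) (vectors X a) _ ⟨
  ∑ (vectors X a) (λ _ → 1 * N ^ b)
    ≤⟨ ∑-mono {xs = vectors X a} step ⟩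
  ∑ (vectors X a) (λ u → (2 ^ c) ^ b * ∑ (vectors X b) (λ v → 𝟙 (separated? a (u Vec.++ v))))
    ≡⟨ ∑-*ˡ ((2 ^ c) ^ b) (vectors X a) _ ⟩
  (2 ^ c) ^ b * ∑ (vectors X a) (λ u → ∑ (vectors X b) (λ v → 𝟙 (separated? a (u Vec.++ v))))
    ≡⟨ cong ((2 ^ c) ^ b *_) (∑-vectors-++ X a b _) ⟨
  (2 ^ c) ^ b * ∑ (vectors X (a + b)) (𝟙 ∘ separated? a) ∎
  where
  open ≤-Reasoning
  X = subsetsOfSize c s
  N = length X
  step : ∀ {u} → u ∈ˡ vectors X a → 1 * N ^ b ≤
         (2 ^ c) ^ b * ∑ (vectors X b) (λ v → 𝟙 (separated? a (u Vec.++ v)))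
  step {u} u∈ = begin
    1 * N ^ b
      ≡⟨ *-identityˡ (N ^ b) ⟩
    N ^ b
      ≤⟨ ^-monoˡ-≤ b (disjoint-share (⋃ u) c (m+n≤o⇒m≤o∸n (∣ ⋃ u ∣ + c) bound)) ⟩
    (2 ^ c * ∑ X (𝟙 ∘ disjoint? (⋃ u))) ^ b
      ≡⟨ [m*n]^o≡m^o*n^o (2 ^ c) _ b ⟩
    (2 ^ c) ^ b * ∑ X (𝟙 ∘ disjoint? (⋃ u)) ^ b
      ≡⟨ cong ((2 ^ c) ^ b *_) (∑-all? X (disjoint? (⋃ u)) b) ⟨
    (2 ^ c) ^ b * ∑ (vectors X b) (𝟙 ∘ all? (disjoint? (⋃ u)))
      ≤⟨ *-monoʳ-≤ ((2 ^ c) ^ b) (∑-mono {xs = vectors X b} (λ {v} _ →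
           𝟙-mono {P? = all? (disjoint? (⋃ u)) v} {separated? a (u Vec.++ v)} (separated-++ u v))) ⟩
    (2 ^ c) ^ b * ∑ (vectors X b) (λ v → 𝟙 (separated? a (u Vec.++ v))) ∎
    where
    bound : ∣ ⋃ u ∣ + c + ∣ ⋃ u ∣ ≤ s
    bound = ≤-trans (+-mono-≤ (+-monoˡ-≤ c (∣⋃∣≤n*c (vectors-All a u∈))) (∣⋃∣≤n*c (vectors-All a u∈)))
      (≤-trans (≤-reflexive (+-comm (a * c + c) (a * c))) le)

-- Greedy colouring

Inj : ∀ {A B : Set} → (A → B) → Set
Inj = Injective _≡_ _≡_

-- If every candidate were hit by `φ`, then by the pigeonhole principle two of the k + 1 candidates
-- would be hit at the same one of the k arguments, and would coincide.
avoid : ∀ {k s} {χ : Fin (suc k) → Fin s} → Inj χ → (φ : Fin k → Fin s) →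
        ∃ λ a → ∀ d → φ d ≢ χ a
avoid {k} {s} {χ} χ-inj φ with Fin.any? (λ a → Fin.all? (λ d → ¬? (φ d Fin.≟ χ a)))
... | yes p = p
... | no ¬p =
  let hit : ∀ a → ∃ λ d → φ d ≡ χ a
      hit a = let d , ¬¬e = Fin.¬∀⟶∃¬ k (λ d → φ d ≢ χ a) (λ d → ¬? (φ d Fin.≟ χ a)) (λ h → ¬p (a , h))
              in d , decidable-stable (φ d Fin.≟ χ a) ¬¬e
      a , b , a<b , e = Fin.pigeonhole (n<1+n k) (proj₁ ∘ hit)
  in contradiction (χ-inj (trans (sym (proj₂ (hit a))) (trans (cong φ e) (proj₂ (hit b)))))
                   (Fin.<⇒≢ a<b)

elements : ∀ {s} (A : Subset s) → Fin ∣ A ∣ → Fin s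
elements (inside  ∷ A) zero    = zero
elements (inside  ∷ A) (suc i) = suc (elements A i)
elements (outside ∷ A) i       = suc (elements A i)

elements-∈ : ∀ {s} (A : Subset s) i → elements A i ∈ A
elements-∈ (inside  ∷ A) zero    = here
elements-∈ (inside  ∷ A) (suc i) = there (elements-∈ A i)
elements-∈ (outside ∷ A) i       = there (elements-∈ A i)

elements-injective : ∀ {s} (A : Subset s) → Inj (elements A)
elements-injective (inside  ∷ A) {zero}  {zero}  _ = refl
elements-injective (inside  ∷ A) {suc i} {suc j} e =
  cong suc (elements-injective A (Fin.suc-injective e))
elements-injective (outside ∷ A) e = elements-injective A (Fin.suc-injective e)

splice : ∀ {A : Set} → ℕ → (ℕ → A) → (ℕ → A) → ℕ → A
splice N g x i with i <? N
... | yes _ = g i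
... | no  _ = x i

module _ {A : Set} {N : ℕ} {g x : ℕ → A} where

  splice-< : ∀ {i} → i < N → splice N g x i ≡ g i
  splice-< {i} i<N with i <? N
  ... | yes _   = refl
  ... | no  i≮N = contradiction i<N i≮N

  splice-≥ : ∀ {i} → N ≤ i → splice N g x i ≡ x i
  splice-≥ {i} N≤i with i <? N
  ... | yes i<N = contradiction i<N (≤⇒≯ N≤i)
  ... | no  _   = refl

-- The periodic extension turns the colours of one round into a total function on the vertices of
-- the path.
at : ∀ {A : Set} k → (Fin (suc k) → A) → ℕ → A
at k ρ i = ρ (i mod suc k)

at-toℕ : ∀ {A : Set} k (ρ : Fin (suc k) → A) b → at k ρ (toℕ b) ≡ ρ b
at-toℕ k ρ b = cong ρ (Fin.toℕ-injective
  (trans (Fin.toℕ-fromℕ< (m%n<n (toℕ b) (suc k))) (m<n⇒m%n≡m (Fin.toℕ<n b))))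

offset : ∀ {K N i} → N ≤ i → i < N + K → ∃ λ (b : Fin K) → i ≡ N + toℕ b
offset {K} {N} {i} N≤i i<N+K with m≤n⇒∃[o]m+o≡n N≤i
... | o , refl = let o<K = +-cancelˡ-< N o K i<N+K in
  fromℕ< o<K , cong (N +_) (sym (Fin.toℕ-fromℕ< o<K))

module _ {s : ℕ} (k : ℕ) (ℓ : ℕ → Subset s) where

  private
    K = suc k

  -- L-colourings of the k-th power of the path 0, …, N - 1; the values of g beyond it are junk.
  record Colours (N : ℕ) (g : ℕ → Fin s) : Set where
    field
      listed : ∀ {i} → i < N → g i ∈ ℓ i
      proper : ∀ {i j} → i < j → j < N → j ≤ i + k → g i ≢ g j
  open Colours public

  Agree : ℕ → (g h : ℕ → Fin s) → Set
  Agree N g h = ∀ {i} → i < N → h i ≡ g i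

  colours-splice : ∀ {N M g x} → Colours N g →
    (∀ {j} → N ≤ j → j < M → x j ∈ ℓ j) →
    (∀ {i j} → i < N → N ≤ j → j < M → j ≤ i + k → g i ≢ x j) →
    (∀ {i j} → N ≤ i → i < j → j < M → j ≤ i + k → x i ≢ x j) →
    Colours M (splice N g x)
  colours-splice {N} {M} {g} {x} c x∈ g≢x x≢x = record
    { listed = λ {i} → lst i ; proper = λ {i} {j} → prp i j }
    where
    lst : ∀ i → i < M → splice N g x i ∈ ℓ i
    lst i i<M with i <? N
    ... | yes i<N = listed c i<N
    ... | no  i≮N = x∈ (≮⇒≥ i≮N) i<M
    prp : ∀ i j → i < j → j < M → j ≤ i + k → splice N g x i ≢ splice N g x j
    prp i j i<j j<M j≤i+k with i <? N | j <? N
    ... | yes i<N | yes j<N = proper c i<j j<N j≤i+k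
    ... | yes i<N | no  j≮N = g≢x i<N (≮⇒≥ j≮N) j<M j≤i+k
    ... | no  i≮N | yes j<N = contradiction (<-trans i<j j<N) i≮N
    ... | no  i≮N | no  j≮N = x≢x (≮⇒≥ i≮N) i<j j<M j≤i+k

  module _ {χ : ℕ → Fin K → Fin s} (χ-inj : ∀ i → Inj (χ i)) where

    -- Each new vertex has at most k earlier neighbours and k + 1 distinct candidates. The last
    -- component, used with `κ` as candidates, is what makes round 0 a permutation of `κ`.
    greedy : ∀ {N g} M → Colours N g → (∀ {i} → N ≤ i → i < N + M → ∀ a → χ i a ∈ ℓ i) →
      ∃ λ h → Agree N g h × Colours (N + M) h ×
              (∀ {i} → N ≤ i → i < N + M → ∃ λ a → h i ≡ χ i a)
    greedy {N} {g} zero c χ∈ = g , (λ _ → refl) , subst (λ M → Colours M g) (sym (+-identityʳ N)) c ,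
      λ N≤i i<N+0 → contradiction (≤-trans i<N+0 (≤-trans (≤-reflexive (+-identityʳ N)) N≤i)) 1+n≰n
    greedy {N} {g} (suc M) c χ∈ rewrite +-suc N M
      with h , agree , d , chosen ← greedy {N} {g} M c (λ N≤i i<T → χ∈ N≤i (m<n⇒m<1+n i<T))
      -- These are the k vertices preceding the new one. If fewer precede it, truncated subtraction
      -- repeats vertex 0, which keeps the number of forbidden colours at most k.
      with a , avoids ← avoid (χ-inj (N + M)) (λ e → h (N + M ∸ suc (toℕ e)))
      = splice T h (λ _ → χ T a)
      , (λ i<N → trans (splice-< (<-≤-trans i<N (m≤m+n N M))) (agree i<N))
      , colours-splice d
          (λ {j} T≤j j<1+T → subst (λ j → χ T a ∈ ℓ j) (≤-antisym T≤j (s≤s⁻¹ j<1+T))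
            (χ∈ (m≤m+n N M) (n<1+n T) a))
          (λ {i} {j} i<T T≤j _ j≤i+k → fresh i i<T (≤-trans T≤j j≤i+k))
          (λ T≤i i<j j<1+T → contradiction (<-≤-trans i<j (≤-trans (s≤s⁻¹ j<1+T) T≤i)) (n≮n _))
      , colour
      where
      T = N + M
      fresh : ∀ i → i < T → T ≤ i + k → h i ≢ χ T a
      fresh i i<T T≤i+k = subst (λ j → h j ≢ χ T a) back (avoids e)
        where
        e<k : T ∸ suc i < k
        e<k = +-cancelˡ-≤ i _ _ (≤-trans (≤-reflexive (trans (+-suc i _) (m+[n∸m]≡n i<T))) T≤i+k)
        e = fromℕ< e<k
        back : T ∸ suc (toℕ e) ≡ i
        back = trans (cong (λ d → T ∸ suc d) (Fin.toℕ-fromℕ< e<k))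
          (trans (cong (T ∸_) (sym (+-∸-assoc 1 i<T))) (m∸[m∸n]≡n (<⇒≤ i<T)))
      colour : ∀ {i} → N ≤ i → i < suc T → ∃ λ b → splice T h (λ _ → χ T a) i ≡ χ i b
      colour {i} N≤i i<1+T with i <? T
      ... | yes i<T = chosen N≤i i<T
      ... | no  i≮T = a , cong (λ j → χ j a) (≤-antisym (≮⇒≥ i≮T) (s≤s⁻¹ i<1+T))

  -- Rounds have length k + 1, so all positions within one are adjacent, position b of the new round
  -- is adjacent to exactly the positions a > b of the previous one, and nothing earlier is
  -- adjacent.
  append-round : ∀ {N g ρ} → Colours (N + K) g → Inj ρ →
    (∀ b → ρ b ∈ ℓ (N + K + toℕ b)) →
    (∀ {a b} → b Fin.< a → g (N + toℕ a) ≢ ρ b) →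
    ∃ λ h → Agree (N + K) g h × Colours (N + K + K) h × (∀ b → h (N + K + toℕ b) ≡ ρ b)
  append-round {N} {g} {ρ} c ρ-inj ρ∈ g≢ρ =
    splice T g x , splice-< , colours-splice c
      (λ T≤j j< → let b , e = offset T≤j j< in subst₂ _∈_ (sym (x-at b e)) (cong ℓ (sym e)) (ρ∈ b))
      old≢new
      (λ T≤i i<j j< _ e →
        let a , i≡ = offset T≤i (<-trans i<j j<)
            b , j≡ = offset (≤-trans T≤i (<⇒≤ i<j)) j<
        in <⇒≢ i<j (trans i≡ (trans (cong (λ c → T + toℕ c)
             (ρ-inj (trans (sym (x-at a i≡)) (trans e (x-at b j≡))))) (sym j≡))))
    , λ b → trans (splice-≥ (m≤m+n T (toℕ b))) (x-at b refl)
    where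
    T = N + K
    rearrange : ∀ N b k → suc (N + b) + k ≡ N + suc k + b
    rearrange = solve-∀
    x : ℕ → Fin s
    x j = at k ρ (j ∸ T)
    x-at : ∀ {j} b → j ≡ T + toℕ b → x j ≡ ρ b
    x-at b refl = trans (cong (at k ρ) (m+n∸m≡n T (toℕ b))) (at-toℕ k ρ b)
    old≢new : ∀ {i j} → i < T → T ≤ j → j < T + K → j ≤ i + k → g i ≢ x j
    old≢new {i} {j} i<T T≤j j< j≤i+k e with offset T≤j j<
    ... | b , refl with N+b<i ← +-cancelʳ-≤ k _ _ (≤-trans (≤-reflexive (rearrange N (toℕ b) k)) j≤i+k)
      with a , refl ← offset {K} {N} (≤-trans (m≤m+n N (toℕ b)) (<⇒≤ N+b<i)) i<T
      = g≢ρ (+-cancelˡ-< N _ _ N+b<i) (trans e (x-at b refl))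

  -- Vertices i and j with i + n ≤ j + k are the ones adjacent across the cut between n - 1 and 0.
  record CyclicColours (n : ℕ) (g : ℕ → Fin s) : Set where
    field
      colours : Colours n g
      closing : ∀ {i j} → j < n → i + n ≤ j + k → g j ≢ g i
  open CyclicColours public

-- Sorting a round

transpose-left : ∀ {n} (i j : Fin n) → transpose i j i ≡ j
transpose-left i j rewrite dec-true (i Fin.≟ i) refl = refl

transpose-right : ∀ {n} (i j : Fin n) → transpose i j j ≡ i
transpose-right i j with j Fin.≟ i
... | yes e = e
... | no  _ rewrite dec-true (j Fin.≟ j) refl = refl

transpose-other : ∀ {n} {i j x : Fin n} → x ≢ i → x ≢ j → transpose i j x ≡ x
transpose-other {i = i} {j} {x} x≢i x≢j
  rewrite dec-false (x Fin.≟ i) x≢i | dec-false (x Fin.≟ j) x≢j = refl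

transpose-injective : ∀ {n} (i j : Fin n) → Inj (transpose i j)
transpose-injective i j e =
  trans (sym (transpose-inverse j i)) (trans (cong (transpose j i) e) (transpose-inverse j i))

-- Recursive rather than P + r * K, so that moving on by one round is a definitional step.
roundStart : (K P r : ℕ) → ℕ
roundStart K P zero    = P
roundStart K P (suc r) = roundStart K P r + K

module _ {s : ℕ} (k : ℕ) (ℓ : ℕ → Subset s) {κ : Fin (suc k) → Fin s} (κ-inj : Inj κ)
         {⋆ : Fin s} (κ≢⋆ : ∀ a → κ a ≢ ⋆) where

  private
    K = suc k

  -- The round at P is the permutation π of κ, up to a ⋆ at the position r - 1 treated last.
  record Sorted (P r : ℕ) (g : ℕ → Fin s) : Set where
    field
      coloured    : Colours k ℓ (P + K) g
      π           : Fin K → Fin K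
      π-injective : Inj π
      fixed       : ∀ {i} → toℕ i < r → π i ≡ i
      last-round  : ∀ a → g (P + toℕ a) ≡ κ (π a) ⊎ (g (P + toℕ a) ≡ ⋆ × suc (toℕ a) ≡ r)

  module _ {P g} (r : Fin K) (S : Sorted P (toℕ r) g) where
    open Sorted S

    -- The swap acts on colours: position r receives r, and the position that held r receives π r.
    -- As earlier positions are fixed, the latter position is r or a later one.
    π′ : Fin K → Fin K
    π′ = transpose r (π r) ∘ π

    π′-fixed : ∀ {i} → toℕ i < suc (toℕ r) → π′ i ≡ i
    π′-fixed {i} i≤r with i Fin.≟ r
    ... | yes refl = transpose-right r (π r)
    ... | no i≢r =
      let πi≡i = fixed (≤∧≢⇒< (s≤s⁻¹ i≤r) (i≢r ∘ Fin.toℕ-injective))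
      in trans (transpose-other (i≢r ∘ trans (sym πi≡i)) (i≢r ∘ π-injective)) πi≡i

    -- An unswapped colour was at position b itself, not at a > b. If b held r, its new colour is π
    -- r, which was at position r; a conflict would need b < r, where π is already the identity.
    π≢π′ : ∀ {a b} → b Fin.< a → b ≢ r → π a ≢ π′ b
    π≢π′ {a} {b} b<a b≢r e = split (π b Fin.≟ r)
      where
      split : ¬ Dec (π b ≡ r)
      split (no πb≢r) = Fin.<⇒≢ b<a (sym (π-injective
        (trans e (transpose-other πb≢r (b≢r ∘ π-injective)))))
      split (yes πb≡r)
        with refl ← π-injective (trans e (trans (cong (transpose r (π r)) πb≡r) (transpose-left r (π r))))
        = b≢r (trans (sym (fixed b<a)) πb≡r)

    -- The colour κ r may have occurred at a later position of the previous round, still adjacent to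
    -- position r here. So `⋆` keeps the place of κ r for one round.
    round : Fin K → Fin s
    round b with b Fin.≟ r
    ... | yes _ = ⋆
    ... | no  _ = κ (π′ b)

    round-injective : Inj round
    round-injective {b} {c} e with b Fin.≟ r | c Fin.≟ r
    ... | yes b≡r | yes c≡r = trans b≡r (sym c≡r)
    ... | yes _   | no  _   = contradiction (sym e) (κ≢⋆ _)
    ... | no  _   | yes _   = contradiction e (κ≢⋆ _)
    ... | no  _   | no  _   = π-injective (transpose-injective r (π r) (κ-inj e))

    previous≢round : ∀ {a b} → b Fin.< a → g (P + toℕ a) ≢ round b
    previous≢round {a} {b} b<a e with b Fin.≟ r | last-round a
    ... | yes refl | inj₁ e′          = κ≢⋆ _ (trans (sym e′) e)
    -- Successive stars sit at positions r - 1 and r of their rounds, hence at distance k + 2.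
    ... | yes refl | inj₂ (_ , 1+a≡r) = <-asym b<a (≤-reflexive 1+a≡r)
    ... | no b≢r   | inj₁ e′          = π≢π′ b<a b≢r (κ-inj (trans (sym e′) e))
    ... | no _     | inj₂ (e′ , _)    = κ≢⋆ _ (trans (sym e) e′)

    sort-step : ⋆ ∈ ℓ (P + K + toℕ r) →
                (∀ {b} → b ≢ r → ∀ c → κ c ∈ ℓ (P + K + toℕ b)) →
                ∃ λ h → Agree k ℓ (P + K) g h × Sorted (P + K) (suc (toℕ r)) h
    sort-step ⋆∈ κ∈ =
      let h , agree , coloured′ , new = append-round k ℓ coloured round-injective round∈ previous≢round
      in h , agree , record
        { coloured = coloured′ ; π = π′
        ; π-injective = π-injective ∘ transpose-injective r (π r)
        ; fixed = π′-fixed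
        ; last-round = λ a → last a (new a)
        }
      where
      round∈ : ∀ b → round b ∈ ℓ (P + K + toℕ b)
      round∈ b with b Fin.≟ r
      ... | yes refl = ⋆∈
      ... | no b≢r   = κ∈ b≢r (π′ b)
      last : ∀ a {x} → x ≡ round a → x ≡ κ (π′ a) ⊎ (x ≡ ⋆ × suc (toℕ a) ≡ suc (toℕ r))
      last a e with a Fin.≟ r
      ... | yes refl = inj₂ (e , refl)
      ... | no _     = inj₁ e

  record Gadget (P : ℕ) : Set where
    field
      initial : ∀ (b : Fin K) c → κ c ∈ ℓ (P + toℕ b)
      star    : ∀ (r : Fin K) → ⋆ ∈ ℓ (roundStart K P (toℕ r) + K + toℕ r)
      plain   : ∀ (r : Fin K) {b} → b ≢ r → ∀ c → κ c ∈ ℓ (roundStart K P (toℕ r) + K + toℕ b)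

  sort : ∀ {P} → Gadget P → ∀ r → r ≤ K → ∀ {g} → Sorted P 0 g →
         ∃ λ h → Agree k ℓ (P + K) g h × Sorted (roundStart K P r) r h
  sort G zero    _   S = _ , (λ _ → refl) , S
  sort {P} G (suc r) r<K {g} S with sort G r (<⇒≤ r<K) S
  ... | h , agree , S′ with fromℕ< r<K | Fin.toℕ-fromℕ< r<K
  ... | r′ | refl =
    let h′ , agree′ , S″ = sort-step r′ S′ (Gadget.star G r′) (Gadget.plain G r′)
    in h′ , (λ i< → trans (agree′ (<-≤-trans i< (start≤ (toℕ r′)))) (agree i<)) , S″
    where
    start≤ : ∀ r → P + K ≤ roundStart K P r + K
    start≤ zero    = ≤-refl
    start≤ (suc r) = ≤-trans (start≤ r) (m≤m+n _ K)

  -- The order of colouring is: the target round with κ in its given order, then M arbitrary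
  -- vertices greedily, then round 0 greedily from κ, then the k + 1 sorting rounds. The last of
  -- these meets the target round across the cut.
  gadget-closes : ∀ M → (χ : ℕ → Fin K → Fin s) → (∀ i → Inj (χ i)) → (∀ i a → χ i a ∈ ℓ i) →
    (∀ (b : Fin K) c → κ c ∈ ℓ (toℕ b)) → Gadget (K + M) →
    ∃ (CyclicColours k ℓ (roundStart K (K + M) K + K))
  gadget-closes M χ χ-inj χ∈ κ∈ G =
    let g₁ , agree₁ , c₁ , _      = greedy k ℓ χ-inj M start (λ {i} _ _ → χ∈ i)
        g₂ , agree₂ , c₂ , chosen = greedy k ℓ (λ _ → κ-inj) K c₁ λ P≤i i<P+K c →
          let b , i≡ = offset P≤i i<P+K in subst (λ i → κ c ∈ ℓ i) (sym i≡) (Gadget.initial G b c)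
        choice = λ (a : Fin K) → chosen (m≤m+n (K + M) (toℕ a)) (+-monoʳ-< (K + M) (Fin.toℕ<n a))
        h , agree , S = sort G K ≤-refl record
          { coloured = c₂ ; π = proj₁ ∘ choice
          -- The positions of a round are pairwise adjacent, so colours chosen there from κ are
          -- distinct.
          ; π-injective = λ {a} {b} e → distinct⇒injective c₂ a b
              (trans (proj₂ (choice a)) (trans (cong κ e) (sym (proj₂ (choice b)))))
          ; fixed = λ () ; last-round = λ a → inj₁ (proj₂ (choice a)) }
        first = λ (b : Fin K) → trans (agree (m≤n⇒m≤n+o K (m≤n⇒m≤n+o M (Fin.toℕ<n b))))
          (trans (agree₂ (m≤n⇒m≤n+o M (Fin.toℕ<n b)))
            (trans (agree₁ (Fin.toℕ<n b)) (at-toℕ k κ b)))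
    in h , record { colours = Sorted.coloured S ; closing = closes h S first }
    where
    start : Colours k ℓ K (at k κ)
    start = record
      { listed = λ i<K → let b , i≡ = offset z≤n i<K in
          subst₂ _∈_ (sym (trans (cong (at k κ) i≡) (at-toℕ k κ b))) (cong ℓ (sym i≡)) (κ∈ b b)
      ; proper = λ i<j j<K _ e →
          let a , i≡ = offset z≤n (<-trans i<j j<K)
              b , j≡ = offset z≤n j<K
          in <⇒≢ i<j (trans i≡ (trans (cong toℕ (κ-inj
               (trans (sym (at-toℕ k κ a)) (trans (cong (at k κ) (sym i≡))
                 (trans e (trans (cong (at k κ) j≡) (at-toℕ k κ b))))))) (sym j≡)))
      }

    near : ∀ P (a b : Fin K) → P + toℕ b ≤ P + toℕ a + k
    near P a b = ≤-trans (+-monoʳ-≤ P (≤-trans (Fin.toℕ≤pred[n] b) (m≤n+m k (toℕ a))))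
      (≤-reflexive (sym (+-assoc P (toℕ a) k)))

    distinct⇒injective : ∀ {P g} → Colours k ℓ (P + K) g → ∀ (a b : Fin K) →
                         g (P + toℕ a) ≡ g (P + toℕ b) → a ≡ b
    distinct⇒injective {P} c a b e with Fin.<-cmp a b
    ... | tri≈ _ a≡b _ = a≡b
    ... | tri< a<b _ _ = contradiction e
      (proper c (+-monoʳ-< P a<b) (+-monoʳ-< P (Fin.toℕ<n b)) (near P a b))
    ... | tri> _ _ b<a = contradiction (sym e)
      (proper c (+-monoʳ-< P b<a) (+-monoʳ-< P (Fin.toℕ<n a)) (near P b a))

    rearrange : ∀ P i k → suc (P + i) + k ≡ i + (P + suc k)
    rearrange = solve-∀

    -- An edge across the cut joins position a of the last round, coloured κ a or `⋆`, to a position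
    -- i < a of the target round, coloured κ i.
    closes : ∀ {P} h → Sorted P K h → (∀ (b : Fin K) → h (toℕ b) ≡ κ b) →
             ∀ {i j} → j < P + K → i + (P + K) ≤ j + k → h j ≢ h i
    closes {P} h S first {i} {j} j<n i+n≤j+k e
      with i+P<j ← +-cancelʳ-≤ k (suc (P + i)) j (≤-trans (≤-reflexive (rearrange P i k)) i+n≤j+k)
      with a , refl ← offset {K} {P} (≤-trans (m≤m+n P i) (<⇒≤ i+P<j)) j<n
      with i<a ← +-cancelˡ-< P i (toℕ a) i+P<j
      with b , refl ← offset {K} {0} z≤n (<-trans i<a (Fin.toℕ<n a))
      with Sorted.last-round S a
    ... | inj₂ (e′ , _) = κ≢⋆ b (trans (sym (first b)) (trans (sym e) e′))
    ... | inj₁ e′ = Fin.<⇒≢ i<a (sym (trans (sym (Sorted.fixed S (Fin.toℕ<n a)))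
                      (κ-inj (trans (sym e′) (trans e (first b))))))

-- From paths to cycles

%-of-difference : ∀ {a b n} .{{_ : NonZero n}} q → ℤ.+ a ℤ.- ℤ.+ b ≡ q ℤ.* ℤ.+ n → a % n ≡ b % n
%-of-difference {a} {b} {n} (ℤ.+ m) e = trans (cong (_% n) (ℤ.+-injective (begin
  ℤ.+ a                         ≡⟨ ℤ.+-identityʳ (ℤ.+ a) ⟨
  ℤ.+ a ℤ.+ ℤ.0ℤ                ≡⟨ cong (λ z → ℤ.+ a ℤ.+ z) (ℤ.+-inverseˡ (ℤ.+ b)) ⟨
  ℤ.+ a ℤ.+ (ℤ.- ℤ.+ b ℤ.+ ℤ.+ b) ≡⟨ ℤ.+-assoc (ℤ.+ a) (ℤ.- ℤ.+ b) (ℤ.+ b) ⟨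
  ℤ.+ a ℤ.- ℤ.+ b ℤ.+ ℤ.+ b     ≡⟨ cong (ℤ._+ ℤ.+ b) e ⟩
  ℤ.+ m ℤ.* ℤ.+ n ℤ.+ ℤ.+ b     ≡⟨ cong (ℤ._+ ℤ.+ b) (sym (ℤ.pos-* m n)) ⟩
  ℤ.+ (m * n + b)               ≡⟨ cong ℤ.+_ (+-comm (m * n) b) ⟩
  ℤ.+ (b + m * n)               ∎))) ([m+kn]%n≡m%n b m n)
  where open ≡-Reasoning
%-of-difference {a} {b} {n} q@(ℤ.-[1+ m ]) e = sym (%-of-difference {b} {a} (ℤ.- q) (begin
  ℤ.+ b ℤ.- ℤ.+ a          ≡⟨ ℤ.+-comm (ℤ.+ b) (ℤ.- ℤ.+ a) ⟩
  ℤ.- ℤ.+ a ℤ.+ ℤ.+ b      ≡⟨ cong (λ z → ℤ.- ℤ.+ a ℤ.+ z) (ℤ.neg-involutive (ℤ.+ b)) ⟨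
  ℤ.- ℤ.+ a ℤ.- ℤ.- ℤ.+ b  ≡⟨ ℤ.neg-distrib-+ (ℤ.+ a) (ℤ.- ℤ.+ b) ⟨
  ℤ.- (ℤ.+ a ℤ.- ℤ.+ b)    ≡⟨ cong ℤ.-_ e ⟩
  ℤ.- (q ℤ.* ℤ.+ n)        ≡⟨ ℤ.neg-distribˡ-* q (ℤ.+ n) ⟩
  ℤ.- q ℤ.* ℤ.+ n          ∎))
  where open ≡-Reasoning

adjacent-% : ∀ {n k} .{{_ : NonZero n}} {x y : Fin n} → CyclePower n k x y →
  ∃ λ d → 1 ≤ d × d ≤ k × (toℕ x % n ≡ (toℕ y + d) % n ⊎ toℕ y % n ≡ (toℕ x + d) % n)
adjacent-% {n} {k} {x} {y} (_ , d , d<1+k , 1≤d , inj₁ (divides q e)) =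
  d , 1≤d , s≤s⁻¹ d<1+k , inj₁ (%-of-difference q (trans (begin
    ℤ.+ toℕ x ℤ.- ℤ.+ (toℕ y + d)
      ≡⟨ cong (λ z → ℤ.+ toℕ x ℤ.+ z) (ℤ.neg-distrib-+ (ℤ.+ toℕ y) (ℤ.+ d)) ⟩
    ℤ.+ toℕ x ℤ.+ (ℤ.- ℤ.+ toℕ y ℤ.- ℤ.+ d)
      ≡⟨ ℤ.+-assoc (ℤ.+ toℕ x) (ℤ.- ℤ.+ toℕ y) (ℤ.- ℤ.+ d) ⟨
    ℤ.+ toℕ x ℤ.- ℤ.+ toℕ y ℤ.- ℤ.+ d ∎) e))
  where open ≡-Reasoning
adjacent-% {n} {k} {x} {y} (_ , d , d<1+k , 1≤d , inj₂ (divides q e)) =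
  d , 1≤d , s≤s⁻¹ d<1+k , inj₂ (sym (%-of-difference q (trans (begin
    ℤ.+ toℕ x ℤ.+ ℤ.+ d ℤ.- ℤ.+ toℕ y
      ≡⟨ ℤ.+-assoc (ℤ.+ toℕ x) (ℤ.+ d) (ℤ.- ℤ.+ toℕ y) ⟩
    ℤ.+ toℕ x ℤ.+ (ℤ.+ d ℤ.- ℤ.+ toℕ y)
      ≡⟨ cong (λ z → ℤ.+ toℕ x ℤ.+ z) (ℤ.+-comm (ℤ.+ d) (ℤ.- ℤ.+ toℕ y)) ⟩
    ℤ.+ toℕ x ℤ.+ (ℤ.- ℤ.+ toℕ y ℤ.+ ℤ.+ d)
      ≡⟨ ℤ.+-assoc (ℤ.+ toℕ x) (ℤ.- ℤ.+ toℕ y) (ℤ.+ d) ⟨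
    ℤ.+ toℕ x ℤ.- ℤ.+ toℕ y ℤ.+ ℤ.+ d ∎) e)))
  where open ≡-Reasoning

toℕ-mod : ∀ i n .{{_ : NonZero n}} → toℕ (i mod n) ≡ i % n
toℕ-mod i n = Fin.toℕ-fromℕ< (m%n<n i n)

-- The vertex e of the cycle is the first one in the order in which g colours.
colourable-from : ∀ {n s k e} .{{_ : NonZero n}} (v : Vec (Subset s) n) → e ≤ n → k < n →
  ∃ (CyclicColours k (λ i → lookup v ((e + i) mod n)) n) → Colourable (CyclePower n k) (lookup v)
colourable-from {n} {s} {k} {e} v e≤n k<n (g , cyclic) = g ∘ index , listed′ , proper′
  where
  index : Fin n → ℕ
  -- Subtraction of e modulo n, kept within the natural numbers.
  index x = (toℕ x + (n ∸ e)) % n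

  index<n : ∀ x → index x < n
  index<n x = m%n<n _ n

  %-+ˡ : ∀ a b → (a % n + b) % n ≡ (a + b) % n
  %-+ˡ a b = trans (%-distribˡ-+ (a % n) b n)
    (trans (cong (λ r → (r + b % n) % n) (m%n%n≡m%n a n)) (sym (%-distribˡ-+ a b n)))

  back : ∀ x → (e + index x) mod n ≡ x
  back x = Fin.toℕ-injective (begin
    toℕ ((e + index x) mod n)    ≡⟨ toℕ-mod (e + index x) n ⟩
    (e + index x) % n            ≡⟨ cong (_% n) (+-comm e (index x)) ⟩
    (index x + e) % n            ≡⟨ %-+ˡ (toℕ x + (n ∸ e)) e ⟩
    (toℕ x + (n ∸ e) + e) % n    ≡⟨ cong (_% n) (trans (+-assoc (toℕ x) _ e)
                                      (cong (toℕ x +_) (m∸n+n≡m e≤n))) ⟩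
    (toℕ x + n) % n              ≡⟨ [m+n]%n≡m%n (toℕ x) n ⟩
    toℕ x % n                    ≡⟨ m<n⇒m%n≡m (Fin.toℕ<n x) ⟩
    toℕ x                        ∎)
    where open ≡-Reasoning

  listed′ : ∀ x → g (index x) ∈ lookup v x
  listed′ x = subst (λ y → g (index x) ∈ lookup v y) (back x) (listed (colours cyclic) (index<n x))

  separate : ∀ {j d} → j < n → 1 ≤ d → d ≤ k → g j ≢ g ((j + d) % n)
  separate {j} {d} j<n 1≤d d≤k with j + d <? n
  ... | yes j+d<n rewrite m<n⇒m%n≡m j+d<n =
    proper (colours cyclic) (m<m+n j 1≤d) j+d<n (+-monoʳ-≤ j d≤k)
  -- The neighbour lies past the end, at i = j + d - n. Since d ≤ k < n, it wraps around only once,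
  -- and the edge is a closing one.
  ... | no  j+d≮n with m≤n⇒∃[o]m+o≡n (≮⇒≥ j+d≮n)
  ...   | i , n+i≡j+d = subst (λ i → g j ≢ g i) (sym wrapped)
    (closing cyclic j<n (≤-trans (≤-reflexive (trans (+-comm i n) n+i≡j+d)) (+-monoʳ-≤ j d≤k)))
    where
    i<n : i < n
    i<n = +-cancelˡ-< n i n (≤-trans (s≤s (≤-reflexive n+i≡j+d))
      (+-mono-<-≤ j<n (≤-trans d≤k (<⇒≤ k<n))))
    wrapped : (j + d) % n ≡ i
    wrapped = trans (cong (_% n) (trans (sym n+i≡j+d) (+-comm n i)))
      (trans ([m+n]%n≡m%n i n) (m<n⇒m%n≡m i<n))

  index-+ : ∀ {x y d} → toℕ x % n ≡ (toℕ y + d) % n → index x ≡ (index y + d) % n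
  index-+ {x} {y} {d} e′ = begin
    (toℕ x + (n ∸ e)) % n             ≡⟨ %-+ˡ (toℕ x) (n ∸ e) ⟨
    (toℕ x % n + (n ∸ e)) % n         ≡⟨ cong (λ r → (r + (n ∸ e)) % n) e′ ⟩
    ((toℕ y + d) % n + (n ∸ e)) % n   ≡⟨ %-+ˡ (toℕ y + d) (n ∸ e) ⟩
    (toℕ y + d + (n ∸ e)) % n         ≡⟨ cong (_% n) (xy∙z≈xz∙y (toℕ y) d (n ∸ e)) ⟩
    (toℕ y + (n ∸ e) + d) % n         ≡⟨ %-+ˡ (toℕ y + (n ∸ e)) d ⟨
    (index y + d) % n                 ∎
    where
    open ≡-Reasoning
    xy∙z≈xz∙y : ∀ x y z → x + y + z ≡ x + z + y
    xy∙z≈xz∙y = solve-∀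

  proper′ : ∀ x y → CyclePower n k x y → g (index x) ≢ g (index y)
  proper′ x y x~y with adjacent-% {n} {k} {x} {y} x~y
  ... | d , 1≤d , d≤k , inj₁ e′ = λ eq → separate (index<n y) 1≤d d≤k
    (trans (sym eq) (cong g (index-+ {x} {y} {d} e′)))
  ... | d , 1≤d , d≤k , inj₂ e′ = λ eq → separate (index<n x) 1≤d d≤k
    (trans eq (cong g (index-+ {y} {x} {d} e′)))

-- The colouring order starts inside the window, so window entries before the start are reached one
-- turn later, at an index larger by n.
lookup-window : ∀ {A : Set} {m n} .{{_ : NonZero n}} {b : Vec A m} {t} {v : Vec A n} → Window b t v →
  ∀ {i} {o : Fin m} → i ≡ t + toℕ o ⊎ i ≡ t + toℕ o + n → lookup v (i mod n) ≡ lookup b o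
lookup-window {m = m} {n} {b} {t} {v} (t+m≤n , h) {i} {o} i≡ =
  h o (i mod n) (trans (toℕ-mod i n) (residue i≡))
  where
  t+o<n : t + toℕ o < n
  t+o<n = <-≤-trans (+-monoʳ-< t (Fin.toℕ<n o)) t+m≤n
  residue : i ≡ t + toℕ o ⊎ i ≡ t + toℕ o + n → i % n ≡ t + toℕ o
  residue (inj₁ refl) = m<n⇒m%n≡m t+o<n
  residue (inj₂ refl) = trans ([m+n]%n≡m%n _ n) (m<n⇒m%n≡m t+o<n)

-- Windows that let the cycle be closed

module _ {s k c : ℕ} (k<c : k < c) where

  private
    K = suc k
    X = subsetsOfSize c s

  candidates : (A : Subset s) → A ∈ˡ X → Fin K → Fin s
  candidates A A∈ a = elements A (inject≤ a (≤-trans k<c (≤-reflexive (sym (∈-subsetsOfSize⁻ A∈)))))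

  candidates-injective : ∀ A A∈ → Inj (candidates A A∈)
  candidates-injective A A∈ e = Fin.inject≤-injective _ _ _ _ (elements-injective A e)

  -- The order starts at position k + 1 of the window, so the last k + 1 vertices carry the first
  -- lists of the block. An edge across the cut joins one of them to a vertex of the second part, by
  -- K ≤ j, and their lists are disjoint.
  separated-colourable : ∀ {j n t} .{{_ : NonZero n}} {b : Vec (Subset s) (K + j)} {v : Vec (Subset s) n} →
    K ≤ j → All (_∈ˡ X) v → Separated K b → Window b t v → Colourable (CyclePower n k) (lookup v)
  separated-colourable {j} {n} {t} {b} {v} K≤j v⊆X sep w@(t+m≤n , _) =
    colourable-from {e = t + K} v t+K≤n (≤-trans (m≤n+m K t) t+K≤n)
      (g , record { colours = coloured ; closing = closes })
    where
    t+K≤n : t + K ≤ n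
    t+K≤n = ≤-trans (+-monoʳ-≤ t (m≤m+n K j)) t+m≤n

    ℓ : ℕ → Subset s
    ℓ i = lookup v ((t + K + i) mod n)

    ℓ⊆X : ∀ i → ℓ i ∈ˡ X
    ℓ⊆X i = lookup⁺ v⊆X ((t + K + i) mod n)

    extension = greedy k ℓ {χ = λ i → candidates (ℓ i) (ℓ⊆X i)}
      (λ i → candidates-injective (ℓ i) (ℓ⊆X i)) {N = 0}
      -- The path is still empty, so this function only has to be total.
      {g = λ i → candidates (ℓ i) (ℓ⊆X i) zero} n
      (record { listed = λ () ; proper = λ _ () })
      (λ {i} _ _ a → elements-∈ (ℓ i) _)
    g = proj₁ extension
    coloured = proj₁ (proj₂ (proj₂ extension))

    shift : ∀ r i k → suc (r + i) + k ≡ i + (suc k + r)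
    shift = solve-∀

    turn : ∀ t k r a → t + suc k + (r + a) ≡ t + a + (suc k + r)
    turn = solve-∀

    closes : ∀ {i i′} → i′ < n → i + n ≤ i′ + k → g i′ ≢ g i
    closes {i} {i′} i′<n i+n≤i′+k e with m≤n⇒∃[o]m+o≡n (≤-trans (m≤n+m K t) t+K≤n)
    ... | r , refl
      with r+i<i′ ← +-cancelʳ-≤ k (suc (r + i)) i′ (≤-trans (≤-reflexive (shift r i k)) i+n≤i′+k)
      with a , refl ← offset {K} {r} (≤-trans (m≤m+n r i) (<⇒≤ r+i<i′))
                                     (<-≤-trans i′<n (≤-reflexive (+-comm K r)))
      with i<a ← +-cancelˡ-< r i (toℕ a) r+i<i′
      with i<j ← <-≤-trans i<a (≤-trans (<⇒≤ (Fin.toℕ<n a)) K≤j)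
      = sep a (fromℕ< i<j) (g i)
          (subst₂ _∈_ e (lookup-window {b = b} {t} {v} w (inj₂ (trans (turn t k r (toℕ a))
             (cong (λ x → t + x + (K + r)) (sym (Fin.toℕ-↑ˡ a j))))))
            (listed coloured i′<n))
          (subst (g i ∈_) (lookup-window {b = b} {t} {v} w (inj₁ (trans (+-assoc t K i)
             (cong (λ x → t + x) (trans (cong (K +_) (sym (Fin.toℕ-fromℕ< i<j)))
                                        (sym (Fin.toℕ-↑ʳ K (fromℕ< i<j))))))))
            (listed coloured (<-trans i<a (<-≤-trans (Fin.toℕ<n a) (m≤m+n K r)))))

  module _ {κ : Fin K → Fin s} (κ-inj : Inj κ) {⋆ : Fin s} (κ≢⋆ : ∀ a → κ a ≢ ⋆)
           {A A⋆ : Subset s} (κ∈A : ∀ a → κ a ∈ A) (⋆∈A⋆ : ⋆ ∈ A⋆) where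

    -- The list at position a of round R.
    entry : ℕ → ℕ → Subset s
    entry R a with R ≟ suc a
    ... | yes _ = A⋆
    ... | no  _ = A

    entry-star : ∀ a → ⋆ ∈ entry (suc a) a
    entry-star a with suc a ≟ suc a
    ... | yes _ = ⋆∈A⋆
    ... | no ¬e = contradiction refl ¬e

    entry-plain : ∀ {R a} → R ≢ suc a → ∀ c → κ c ∈ entry R a
    entry-plain {R} {a} R≢1+a c with R ≟ suc a
    ... | yes e = contradiction e R≢1+a
    ... | no  _ = κ∈A c

    gadgetAt : Fin ((3 + k) * K) → Subset s
    gadgetAt o = let R , a = remQuot {3 + k} K o in entry (toℕ R) (toℕ a)

    gadget : Vec (Subset s) ((3 + k) * K)
    gadget = tabulate gadgetAt

    lookup-gadget : ∀ (R : Fin (3 + k)) (a : Fin K) → lookup gadget (combine R a) ≡ entry (toℕ R) (toℕ a)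
    lookup-gadget R a = trans (lookup∘tabulate gadgetAt (combine R a))
      (cong (uncurry λ R a → entry (toℕ R) (toℕ a)) (Fin.remQuot-combine R a))

    gadget-All : ∀ {Q : Pred (Subset s) 0ℓ} → Q A → Q A⋆ → ∀ i → Q (lookup gadget i)
    gadget-All {Q} qA qA⋆ i = subst Q (sym (lookup∘tabulate gadgetAt i))
      (go (toℕ (proj₁ (remQuot {3 + k} K i))) (toℕ (proj₂ (remQuot {3 + k} K i))))
      where
      go : ∀ R a → Q (entry R a)
      go R a with R ≟ suc a
      ... | yes _ = qA⋆
      ... | no  _ = qA

    gadget-colourable : ∀ {n t} .{{_ : NonZero n}} {v : Vec (Subset s) n} →
      All (_∈ˡ X) v → Window gadget t v → Colourable (CyclePower n k) (lookup v)
    gadget-colourable {n} {t} {v} v⊆X w@(t+m≤n , _)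
      with m≤n⇒∃[o]m+o≡n (≤-trans (m≤n+m ((3 + k) * K) t) t+m≤n)
    ... | M , m+M≡n = colourable-from v e≤n (≤-trans (m≤n+m K _) e+K≤n)
        (subst (∃ ∘ CyclicColours k ℓ) total
          (gadget-closes k ℓ κ-inj κ≢⋆ M (λ i → candidates (ℓ i) (ℓ⊆X i))
            (λ i → candidates-injective (ℓ i) (ℓ⊆X i)) (λ i a → elements-∈ (ℓ i) _)
            target record { initial = initial′ ; star = star′ ; plain = plain′ }))
      where
      -- The start of the last of the k + 3 rounds. From there the order runs through the M vertices
      -- outside the window and then enters round 0.
      e = t + (2 + k) * K
      ℓ : ℕ → Subset s
      ℓ i = lookup v ((e + i) mod n)

      ℓ⊆X : ∀ i → ℓ i ∈ˡ X
      ℓ⊆X i = lookup⁺ v⊆X ((e + i) mod n)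

      e+K≤n : e + K ≤ n
      e+K≤n = ≤-trans (≤-reflexive (rearrange t k)) t+m≤n
        where
        rearrange : ∀ t k → t + (2 + k) * suc k + suc k ≡ t + (3 + k) * suc k
        rearrange = solve-∀
      e≤n : e ≤ n
      e≤n = ≤-trans (m≤m+n e K) e+K≤n

      start≡ : ∀ P r → roundStart K P r ≡ P + r * K
      start≡ P zero    = sym (+-identityʳ P)
      start≡ P (suc r) = trans (cong (_+ K) (start≡ P r)) (rearrange P (r * K) K)
        where
        rearrange : ∀ a b c → a + b + c ≡ a + (c + b)
        rearrange = solve-∀

      total : roundStart K (K + M) K + K ≡ n
      total = trans (cong (_+ K) (start≡ (K + M) K)) (trans (rearrange k M) m+M≡n)
        where
        rearrange : ∀ k M → suc k + M + suc k * suc k + suc k ≡ (3 + k) * suc k + M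
        rearrange = solve-∀

      ℓ-entry : ∀ {i} (R : Fin (3 + k)) (a : Fin K) →
                e + i ≡ t + (K * toℕ R + toℕ a) ⊎ e + i ≡ t + (K * toℕ R + toℕ a) + n →
                ℓ i ≡ entry (toℕ R) (toℕ a)
      ℓ-entry {i} R a i≡ = trans
        (lookup-window {b = gadget} {t} {v} w
          (subst (λ o → e + i ≡ t + o ⊎ e + i ≡ t + o + n) (sym (Fin.toℕ-combine R a)) i≡))
        (lookup-gadget R a)

      target : ∀ b c → κ c ∈ ℓ (toℕ b)
      target b c = subst (κ c ∈_)
        (sym (ℓ-entry R b (inj₁ (trans (rearrange t k (toℕ b))
          (cong (λ R → t + (K * R + toℕ b)) (sym (Fin.toℕ-fromℕ (2 + k))))))))
        -- The last round has number k + 2, so its star would be at position k + 1, just beyond the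
        -- end of the round.
        (entry-plain {toℕ R} (λ R≡1+b → 1+n≰n (≤-trans
          (≤-reflexive (trans (sym (Fin.toℕ-fromℕ (2 + k))) R≡1+b)) (Fin.toℕ<n b))) c)
        where
        R = fromℕ (2 + k)
        rearrange : ∀ t k b → t + (2 + k) * suc k + b ≡ t + (suc k * (2 + k) + b)
        rearrange = solve-∀

      before : ∀ x → e + (K + M + x) ≡ t + x + n
      before x = trans (rearrange t k M x) (cong (t + x +_) m+M≡n)
        where
        rearrange : ∀ t k M x → t + (2 + k) * suc k + (suc k + M + x) ≡ t + x + ((3 + k) * suc k + M)
        rearrange = solve-∀

      initial′ : ∀ b c → κ c ∈ ℓ (K + M + toℕ b)
      initial′ b c = subst (κ c ∈_)
        (sym (ℓ-entry zero b (inj₂ (trans (before (toℕ b))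
          (cong (λ z → t + (z + toℕ b) + n) (sym (*-zeroʳ K)))))))
        (entry-plain {0} {toℕ b} (λ ()) c)

      round-entry : ∀ (r b : Fin K) → ℓ (roundStart K (K + M) (toℕ r) + K + toℕ b) ≡ entry (suc (toℕ r)) (toℕ b)
      round-entry r b = trans (ℓ-entry R b (inj₂ (trans (cong (e +_) (trans
          (cong (λ P → P + K + toℕ b) (start≡ (K + M) (toℕ r))) (rearrange k M (toℕ r) (toℕ b))))
          (trans (before _) (cong (λ R → t + (K * R + toℕ b) + n) (sym R≡))))))
        (cong (λ R → entry R (toℕ b)) R≡)
        where
        R : Fin (3 + k)
        R = Fin.suc (inject≤ r (n≤1+n K))
        R≡ : toℕ R ≡ suc (toℕ r)
        R≡ = cong suc (Fin.toℕ-inject≤ r (n≤1+n K))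
        rearrange : ∀ k M r b → suc k + M + r * suc k + suc k + b ≡ suc k + M + (suc k * suc r + b)
        rearrange = solve-∀

      star′ : ∀ r → ⋆ ∈ ℓ (roundStart K (K + M) (toℕ r) + K + toℕ r)
      star′ r = subst (⋆ ∈_) (sym (round-entry r r)) (entry-star (toℕ r))

      plain′ : ∀ r {b} → b ≢ r → ∀ c → κ c ∈ ℓ (roundStart K (K + M) (toℕ r) + K + toℕ b)
      plain′ r {b} b≢r c = subst (κ c ∈_) (sym (round-entry r b))
        (entry-plain {suc (toℕ r)} {toℕ b} (λ e → b≢r (Fin.toℕ-injective (sym (suc-injective e)))) c)

-- Good blocks for every number of colours, and the limit

subsetOfSize-∈ : ∀ {c s} (c≤s : c ≤ s) {i : Fin s} → toℕ i < c → i ∈ proj₁ (subsetOfSize c≤s)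
subsetOfSize-∈ (s≤s c≤s) {zero}  _         = here
subsetOfSize-∈ (s≤s c≤s) {suc i} (s≤s i<c) = there (subsetOfSize-∈ c≤s i<c)

-- Colours before `x` are left out as long as enough remain; once exactly c are left, all of them
-- are taken.
subsetOfSizeContaining : ∀ {c s} → 0 < c → c ≤ s → (x : Fin s) → ∃ λ (p : Subset s) → x ∈ p × ∣ p ∣ ≡ c
subsetOfSizeContaining (s≤s _) (s≤s c≤s) zero =
  let p , ∣p∣≡c = subsetOfSize c≤s in inside ∷ p , here , cong suc ∣p∣≡c
subsetOfSizeContaining {c} {suc s} 0<c c≤1+s (suc x) with c ≟ suc s
... | yes refl = ⊤ , ∈⊤ , ∣⊤∣≡n (suc s)
... | no c≢1+s =
  let p , x∈p , ∣p∣≡c = subsetOfSizeContaining 0<c (s≤s⁻¹ (≤∧≢⇒< c≤1+s c≢1+s)) x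
  in outside ∷ p , there x∈p , ∣p∣≡c

module _ (c k : ℕ) (k<c : k < c) where

  private
    K = suc k
    b = (2 + k) * K
    -- This unfolds to (3 + k) * K, the length of the gadget, and is split as the separated blocks
    -- require.
    m = K + b
    -- The number of colours from which `separated-share` applies with a = K. Up to it there are at
    -- most 2 ^ threshold lists, which bounds the number of blocks.
    threshold = K * c + (K * c + c)

    d : ℕ
    d = (2 ^ threshold) ^ m + (2 ^ c) ^ b

  -- d bounds the failure odds for both kinds of good blocks, whichever is used for s.
  record Closable (s : ℕ) : Set₁ where
    field
      Good       : Pred (Vec (Subset s) m) 0ℓ
      good?      : Decidable Good
      share      : length (subsetsOfSize c s) ^ m ≤ suc d * ∑ (vectors (subsetsOfSize c s) m) (𝟙 ∘ good?)
      colourable : ∀ {n t} .{{_ : NonZero n}} {w} {v : Vec (Subset s) n} → All (_∈ˡ subsetsOfSize c s) v →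
                   Good w → Window w t v → Colourable (CyclePower n k) (lookup v)

  closable-large : ∀ {s} → threshold ≤ s → Closable s
  closable-large {s} large = record
    { Good = Separated K ; good? = separated? K
    ; share = ≤-trans (separated-share K b large)
        (*-monoˡ-≤ (∑ (vectors (subsetsOfSize c s) m) (𝟙 ∘ separated? K))
          (m≤n⇒m≤1+n (m≤n+m ((2 ^ c) ^ b) ((2 ^ threshold) ^ m))))
    ; colourable = λ {_} {t} {w} {v} → separated-colourable k<c {b = w} {v} (m≤m+n K _) }

  -- A single block out of boundedly many has a share bounded from below. By K < s the colour
  -- numbered K is available as `⋆`, beside the first k + 1 colours as `κ`.
  closable-small : ∀ {s} → c ≤ s → K < s → s ≤ threshold → Closable s
  closable-small {s} c≤s K<s small = record
    { Good = _≡ word ; good? = λ w → ≡-dec (≡-dec Bool._≟_) w word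
    ; share = begin
        N ^ m                     ≤⟨ ^-monoˡ-≤ m (≤-trans (length-subsetsOfSize-≤ c s) (^-monoʳ-≤ 2 small)) ⟩
        (2 ^ threshold) ^ m       ≤⟨ m≤n⇒m≤1+n (m≤m+n _ _) ⟩
        suc d                     ≡⟨ *-identityʳ (suc d) ⟨
        suc d * 1                 ≤⟨ *-monoʳ-≤ (suc d) (∑-≥1 _ word∈ (≤-reflexive (sym
                                       (𝟙-true {P? = ≡-dec (≡-dec Bool._≟_) word word} refl)))) ⟩
        suc d * ∑ (vectors X m) (λ w → 𝟙 (≡-dec (≡-dec Bool._≟_) w word)) ∎
    ; colourable = λ { v⊆X refl → gadget-colourable k<c κ-inj κ≢⋆ κ∈A ⋆∈A⋆ v⊆X } }
    where
    open ≤-Reasoning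
    X = subsetsOfSize c s
    N = length X
    κ : Fin K → Fin s
    κ a = inject≤ a (<⇒≤ K<s)
    κ-inj : Inj κ
    κ-inj = Fin.inject≤-injective _ _ _ _
    ⋆ = fromℕ< K<s
    κ≢⋆ : ∀ a → κ a ≢ ⋆
    κ≢⋆ a e = <⇒≢ (Fin.toℕ<n a) (trans (sym (Fin.toℕ-inject≤ a _))
      (trans (cong toℕ e) (Fin.toℕ-fromℕ< K<s)))
    plain = subsetOfSize c≤s
    starred = subsetOfSizeContaining (≤-trans (s≤s z≤n) k<c) c≤s ⋆
    κ∈A : ∀ a → κ a ∈ proj₁ plain
    κ∈A a = subsetOfSize-∈ c≤s
      (≤-trans (≤-reflexive (cong suc (Fin.toℕ-inject≤ a _))) (≤-trans (Fin.toℕ<n a) k<c))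
    ⋆∈A⋆ = proj₁ (proj₂ starred)
    word : Vec (Subset s) m
    word = gadget k<c κ-inj κ≢⋆ κ∈A ⋆∈A⋆
    word∈ : word ∈ˡ vectors X m
    word∈ = ∈-vectors word (gadget-All k<c κ-inj κ≢⋆ κ∈A ⋆∈A⋆ {Q = _∈ˡ X}
      (∈-subsetsOfSize⁺ (proj₂ plain)) (∈-subsetsOfSize⁺ (proj₂ (proj₂ starred))))

  closable : ∀ {s} → c ≤ s → K < s → Closable s
  closable {s} c≤s K<s with ≤-total threshold s
  ... | inj₁ large = closable-large large
  ... | inj₂ small = closable-small c≤s K<s small

  tendsTo-1 : (s : ℕ → ℕ) (c≤s : ∀ n → c ≤ s n) → (∀ n → K < s n) →
              TendsTo (λ n → p n c k (s n) (c≤s n)) 1ℚ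
  tendsTo-1 s c≤s K<s ε 0<ε = q * m , λ n qm≤n →
    -- The kind of good block may vary with n, as s n does, whereas m, d and q stay the same.
    let open Closable (closable (c≤s n) (K<s n))
        X   = subsetsOfSize c (s n)
        col? = λ (L : Vec (Subset (s n)) n) → colourable? (cyclePower? n k) (lookup L)
        instance
          n≢0 : NonZero n
          n≢0 = >-nonZero (≤-trans (s≤s z≤n) qm≤n)
          nonEmpty : NonZero (length (vectors X n))
          nonEmpty = listAssignments-nonEmpty n (c≤s n)
        decay = avoidance X good? d share q qm≤n col? (λ {w} {t} v⊆X good → colourable v⊆X good)
    in probability-near-1 (vectors X n) col? ε 0<ε
      (small-ratio {d} {q} (ℚ.↧ₙ ε)
        (subst (λ t → (d + q) * ∑ (vectors X n) (𝟙 ∘ ¬? ∘ col?) ≤ d * t)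
          (sym (length-vectors X n)) (geometric-decay d q decay))
        (n<1+n (d * ℚ.↧ₙ ε)))
    where
    -- The least q that `small-ratio` accepts when e is the denominator of ε.
    q = suc (d * ℚ.↧ₙ ε)

theorem3p2 :
    (c k : ℕ) → 0 < c → 0 < k → (s : ℕ → ℕ) → (∀ n → 0 < s n) →
    (c ≡ k + 1 → (c<s : ∀ n → c < s n) → TendsTo (λ n → p n c k (s n) (<⇒≤ (c<s n))) 1ℚ)
    × (k + 1 < c → (c≤s : ∀ n → c ≤ s n) → TendsTo (λ n → p n c k (s n) (c≤s n)) 1ℚ)
theorem3p2 c k _ _ s _
  -- Both cases provide more than k + 1 colours: the first by c < s n, the second by k + 1 < c ≤ s
  -- n.
  = (λ c≡k+1 c<s → let c≡1+k = trans c≡k+1 (+-comm k 1) in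
      tendsTo-1 c k (≤-reflexive (sym c≡1+k)) s (<⇒≤ ∘ c<s) (λ n → subst (_< s n) c≡1+k (c<s n)))
  , (λ k+1<c c≤s → let 1+k<c = subst (_< c) (+-comm k 1) k+1<c in
      tendsTo-1 c k (<⇒≤ 1+k<c) s c≤s (λ n → <-≤-trans 1+k<c (c≤s n)))
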